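{- Let $\mathcal{C}$ be a permutation class containing $12$ and $21$ and containing only finitely many simple permutations. Let $B$ be the (finite) basis of $\mathcal{C}$, let $B^\star$ be the set of non-simple permutations in $B$, and let $\mathcal{S}_{\mathcal{C}}$ be the (finite) set of simple permutations in $\mathcal{C}$. There is an algorithm which, given $B$ and $\mathcal{S}_{\mathcal{C}}$, computes a finite system of combinatorial equations describing $\mathcal{C}$ with the following properties. Every equation is of the form $\mathcal{D}_0 = \{1\} \cup \bigcup \pi[\mathcal{D}_1,\dots,\mathcal{D}_n]$ (a finite union, each $\pi$ being $\oplus$, $\ominus$ or a simple permutation, $n=|\pi|$), and is a true equality of sets of permutations; each $\mathcal{D}_i$ occurring in the system is of the form $\hat{\mathcal{C}}^{\delta}\langle B^\star \cup B_i\rangle$ with $\delta \in \{\,\cdot\,, +, -\}$ (i.e. $\hat{\mathcal{C}}^\delta$ is $\hat{\mathcal{C}}$, $\hat{\mathcal{C}}^+$ or $\hat{\mathcal{C}}^-$) and $B_i$ a set consisting only of normalized blocks of elements of $B^\star$. The system contains an equation whose left part is $\mathcal{C}$, and it is complete: every $\mathcal{D}_i$ appearing in the system is the left part of some equation of the system.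
   Context: A permutation of size $n$ is a bijection of $\{1,\dots,n\}$, written as the word $\sigma_1\cdots\sigma_n$; $\varepsilon$ is the permutation of size $0$. For $\sigma$ of size $n$ and $I=\{i_1<\dots<i_k\}\subseteq\{1,\dots,n\}$, $\sigma_I$ is the permutation order-isomorphic to $\sigma_{i_1}\cdots\sigma_{i_k}$. A permutation $\pi$ is a pattern of $\sigma$ ($\pi\preccurlyeq\sigma$) if $\sigma_I=\pi$ for some $I$; otherwise $\sigma$ avoids $\pi$. A permutation class is a set of permutations of size $\ge 1$ closed under taking patterns; its basis is the set of $\preccurlyeq$-minimal permutations not in it. An interval of $\sigma$ is a nonempty set of consecutive indices $\{i,\dots,i+\ell-1\}$ whose images form a set of consecutive integers; a normalized block of $\sigma$ is $\sigma_I$ for $I$ an interval. A permutation is simple if it has size $\ge 4$ and its only intervals are the singletons and the whole index set. For $\sigma$ of size $n$ and nonempty permutations $\pi^1,\dots,\pi^n$, the substitution $\sigma[\pi^1,\dots,\pi^n]$ is the permutation obtained by concatenating sequences $S^1,\dots,S^n$, where $S^i$ is order-isomorphic to $\pi^i$ and consists of consecutive integers, and the entries of $S^i$ are smaller than those of $S^j$ iff $\sigma_i<\sigma_j$. Write $\oplus=12$, $\ominus=21$. A permutation is $\oplus$-indecomposable (resp. $\ominus$-indecomposable) if it cannot be written $\oplus[\pi^1,\pi^2]$ (resp. $\ominus[\pi^1,\pi^2]$). For sets $\mathcal{D}_1,\dots,\mathcal{D}_n$ of permutations, $\pi[\mathcal{D}_1,\dots,\mathcal{D}_n]=\{\pi[\sigma_1,\dots,\sigma_n]:\sigma_i\in\mathcal{D}_i\}$.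 The substitution closure of $\mathcal{C}$ is $\hat{\mathcal{C}}=\bigcup_{k\ge1}\mathcal{C}^k$ with $\mathcal{C}^1=\mathcal{C}$ and $\mathcal{C}^{k+1}=\{\sigma[\pi^1,\dots,\pi^{|\sigma|}]:\sigma\in\mathcal{C},\pi^i\in\mathcal{C}^k\}$. For a set $\mathcal{A}$ of permutations, $\mathcal{A}^+$ (resp. $\mathcal{A}^-$) is the set of its $\oplus$-indecomposable (resp. $\ominus$-indecomposable) elements, and $\mathcal{A}\langle E\rangle$ is the set of elements of $\mathcal{A}$ avoiding every pattern in $E$. $\{1\}$ denotes the set containing only the permutation of size $1$. -}

module Defs where

open import Level using (0ℓ)
open import Data.Nat using (ℕ; zero; suc; _+_; _≤_; _<ᵇ_; _<?_)
open import Data.Bool using (if_then_else_)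
open import Data.List using (List; []; _∷_; _++_; length; map; filter; zipWith; concat; upTo)
open import Data.Nat.ListAction using (sum)
open import Data.List.Membership.Propositional using (_∈_)
open import Data.List.Relation.Unary.All using (All)
open import Data.List.Relation.Unary.Any using (Any)
open import Data.List.Relation.Binary.Pointwise using (Pointwise)
open import Data.List.Relation.Binary.Sublist.Propositional using (_⊆_)
open import Data.List.Relation.Binary.Permutation.Propositional using (_↭_)
open import Data.Fin using (Fin)
open import Data.Product using (Σ; ∃; ∃-syntax; _×_; proj₁; proj₂)
open import Data.Sum using (_⊎_)
open import Relation.Nullary using (¬_)
open import Relation.Unary using (Pred)
open import Relation.Binary.PropositionalEquality using (_≡_; _≢_)
open import Function.Bundles using (_⇔_)

-- Words are lists of naturals. A permutation of size n is represented
-- 0-based: a word that is a rearrangement of 0,1,...,n-1.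
Word : Set
Word = List ℕ

IsPerm : Word → Set
IsPerm w = w ↭ upTo (length w)

PSet : Set₁
PSet = Pred Word 0ℓ

-- standardisation: the permutation order-isomorphic to a word with distinct entries
rank : Word → ℕ → ℕ
rank w x = length (filter (_<? x) w)

std : Word → Word
std w = map (rank w) w

_≼_ : Word → Word → Set
π ≼ σ = ∃[ τ ] (τ ⊆ σ × std τ ≡ π)

Avoids : PSet → Word → Set
Avoids E σ = ∀ π → E π → ¬ (π ≼ σ)

Consec : Word → Set
Consec m = ∃[ a ] (m ↭ map (a +_) (upTo (length m)))

NormBlock : Word → Word → Set
NormBlock β σ = ∃[ pre ] ∃[ mid ] ∃[ suf ]
  (σ ≡ pre ++ mid ++ suf × mid ≢ [] × Consec mid × β ≡ std mid)

Simple : Word → Set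
Simple σ = IsPerm σ × 4 ≤ length σ ×
  (∀ pre mid suf → σ ≡ pre ++ mid ++ suf → mid ≢ [] → Consec mid →
     length mid ≡ 1 ⊎ (pre ≡ [] × suf ≡ []))

-- substitution σ[π¹,…,πⁿ] (σ and the πⁱ 0-based permutations, ps of length |σ|)
offset : Word → List Word → ℕ → ℕ
offset σ ps s = sum (zipWith (λ t p → if t <ᵇ s then length p else 0) σ ps)

inflate : Word → List Word → Word
inflate σ ps = concat (zipWith (λ s p → map (offset σ ps s +_) p) σ ps)

oplus : Word
oplus = 0 ∷ 1 ∷ []

ominus : Word
ominus = 1 ∷ 0 ∷ []

one : Word
one = 0 ∷ []

⊕-Decomposable : Word → Set
⊕-Decomposable σ = ∃[ p ] ∃[ q ]
  (IsPerm p × IsPerm q × p ≢ [] × q ≢ [] × σ ≡ inflate oplus (p ∷ q ∷ []))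

⊖-Decomposable : Word → Set
⊖-Decomposable σ = ∃[ p ] ∃[ q ]
  (IsPerm p × IsPerm q × p ≢ [] × q ≢ [] × σ ≡ inflate ominus (p ∷ q ∷ []))

Av : List Word → PSet
Av B σ = IsPerm σ × 1 ≤ length σ × Avoids (_∈ B) σ

IsBasis : List Word → Set
IsBasis B = All (λ b → IsPerm b × 1 ≤ length b × ¬ Av B b ×
                  (∀ π → π ≼ b → π ≢ b → 1 ≤ length π → Av B π)) B

-- the levels C^k (CLevel C 0 = C^1) and the substitution closure
CLevel : PSet → ℕ → PSet
CLevel C zero = C
CLevel C (suc k) σ = ∃[ τ ] ∃[ ps ]
  (C τ × length ps ≡ length τ × Pointwise (λ _ p → CLevel C k p) τ ps × σ ≡ inflate τ ps)

SubstClosure : PSet → PSet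
SubstClosure C σ = ∃[ k ] CLevel C k σ

data Delta : Set where
  plain plus minus : Delta

restrictδ : Delta → PSet → PSet
restrictδ plain A σ = A σ
restrictδ plus  A σ = A σ × ¬ ⊕-Decomposable σ
restrictδ minus A σ = A σ × ¬ ⊖-Decomposable σ

BStar : List Word → PSet
BStar B π = π ∈ B × ¬ Simple π

DSet : List Word → Delta → List Word → PSet
DSet B δ Bi σ = restrictδ δ (SubstClosure (Av B)) σ × Avoids (λ π → BStar B π ⊎ π ∈ Bi) σ

-- combinatorial systems: m variables 𝒟_0..𝒟_{m-1}, each described by (δ, Bᵢ)
record Term (m : ℕ) : Set where
  constructor term
  field
    root : Word
    args : List (Fin m)
open Term public

record System : Set where
  constructor system
  field
    nvars : ℕ
    var   : Fin nvars → Delta × List Word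
    eqns  : List (Fin nvars × List (Term nvars))
open System public

module _ (B : List Word) (Sy : System) where

  ⟦_⟧ : Fin (nvars Sy) → PSet
  ⟦ i ⟧ = DSet B (proj₁ (var Sy i)) (proj₂ (var Sy i))

  TermSet : Term (nvars Sy) → PSet
  TermSet t σ = ∃[ ps ] (Pointwise (λ i p → ⟦ i ⟧ p) (args t) ps × σ ≡ inflate (root t) ps)

  RHS : List (Term (nvars Sy)) → PSet
  RHS ts σ = σ ≡ one ⊎ Any (λ t → TermSet t σ) ts

  WellFormedTerm : Term (nvars Sy) → Set
  WellFormedTerm t = (root t ≡ oplus ⊎ root t ≡ ominus ⊎ Simple (root t))
                     × length (args t) ≡ length (root t)

  IsLhs : Fin (nvars Sy) → Set
  IsLhs i = Any (λ e → proj₁ e ≡ i) (eqns Sy)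

  ValidSystem : Set
  ValidSystem =
    (∀ i → All (λ β → ∃[ b ] (BStar B b × NormBlock β b)) (proj₂ (var Sy i)))
    × All (λ e → All WellFormedTerm (proj₂ e) ×
                 (∀ σ → ⟦ proj₁ e ⟧ σ ⇔ RHS (proj₂ e) σ)) (eqns Sy)
    × Any (λ e → ∀ σ → ⟦ proj₁ e ⟧ σ ⇔ Av B σ) (eqns Sy)
    × All (λ e → All (λ t → All IsLhs (args t)) (proj₂ e)) (eqns Sy)

{-# OPTIONS --safe #-}

-- A pattern of π[σ₁,…,σₙ] is the same thing as an inflation π[γ₁,…,γₙ] with each γᵢ a possibly empty
-- pattern of σᵢ, and the nonempty γᵢ are then normalized blocks of it. For a simple pattern these blocks
-- are trivial, so Ĉ is the set of nonempty permutations all of whose simple patterns lie in C; merging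
-- adjacent intervals writes each of them as 1 or as an inflation of ⊕, ⊖ or a simple permutation of C,
-- and Ĉ⟨B⋆⟩ = C because a simple element of B cannot occur in an element of Ĉ.
--
-- The unknowns are Ĉ⟨B⋆ ∪ E⟩ for all sets E of blocks of size ≥ 2 of elements of B⋆. In the equation of
-- E₀ the term π[E₁,…,Eₙ] is present iff no π[γ₁,…,γₙ] with all nonempty γᵢ blocks outside Eᵢ belongs to
-- B⋆ ∪ E₀. Such a term avoids B⋆ ∪ E₀; conversely, π[σ₁,…,σₙ] avoiding B⋆ ∪ E₀ lies in the term in
-- which Eᵢ consists of all blocks avoided by σᵢ.
module Submission where

open import Defs
open import Data.Bool using (true; false; if_then_else_)
open import Data.Empty using (⊥; ⊥-elim)
open import Data.List using (List; _∷_; []; [_]; _++_; length; map; filter; zipWith; concat; concatMap; upTo; allFin; lookup)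
open import Data.Fin using (Fin)
open import Data.List.Membership.Propositional using (_∈_; _∉_; find; lose)
open import Data.List.Membership.Propositional.Properties
open import Data.List.Properties
open import Data.List.Relation.Binary.Permutation.Propositional using (_↭_; ↭-sym; ↭-trans; ↭-refl; ↭-reflexive; prep; ↭⇒↭ₛ)
open import Data.List.Relation.Binary.Permutation.Propositional.Properties using (∈-resp-↭; ↭-length; shift; shifts; filter-↭; All-resp-↭)
import Data.List.Relation.Binary.Permutation.Propositional.Properties as ↭
import Data.List.Relation.Binary.Permutation.Setoid.Properties as ↭ₛ
open import Data.List.Relation.Binary.Pointwise using (Pointwise; []; _∷_)
open import Data.List.Relation.Binary.Sublist.Propositional using (_⊆_; []; _∷_; _∷ʳ_; ⊆-refl; ⊆-trans)
import Data.List.Relation.Binary.Sublist.Propositional as ⊆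
import Data.List.Relation.Binary.Sublist.Propositional.Properties as ⊆
open import Data.List.Relation.Unary.All as All using (All; []; _∷_)
import Data.List.Relation.Unary.All.Properties as All
open import Data.List.Relation.Unary.AllPairs as AllPairs using (AllPairs; []; _∷_)
import Data.List.Relation.Unary.AllPairs.Properties as AllPairs
open import Data.List.Relation.Unary.Any as Any using (Any; here; there)
import Data.List.Relation.Unary.Any.Properties as Any
open import Data.List.Relation.Unary.Unique.Propositional using (Unique)
import Data.List.Relation.Unary.Unique.Propositional.Properties as Unique
open import Data.Nat using (ℕ; zero; suc; _+_; _∸_; _≤_; _<_; _<ᵇ_; _<?_; _≤?_; _≟_; z≤n; s≤s)
open import Data.Nat.Properties hiding (_≟_; _<?_; _≤?_)
open import Data.Product using (Σ; ∃-syntax; _×_; _,_; proj₁; proj₂; map₁; map₂)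
open import Data.Sum using (_⊎_; inj₁; inj₂; [_,_]′)
open import Function using (_∘_; id; case_of_)
open import Function.Bundles using (_⇔_; mk⇔; Equivalence)
open import Relation.Binary.Definitions using (tri<; tri≈; tri>)
open import Relation.Binary.PropositionalEquality using (_≡_; _≢_; refl; sym; trans; cong; cong₂; subst; subst₂; ≢-sym; setoid; resp₂; module ≡-Reasoning)
open import Relation.Nullary using (¬_; Dec; yes; no; contradiction; ¬?; _×-dec_; _→-dec_; _⊎-dec_)
open import Relation.Nullary.Decidable using (map′; decidable-stable)
open import Relation.Unary using (Decidable)

-- Ranks and standardisation

-- Inflations are defined by counting offsets, whereas patterns and blocks are standardised
-- subwords. The bridge is `std-concat`: standardising a concatenation of words, any two of which
-- lie entirely above or below each other, gives an inflation. Both directions need it, to cut an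
-- occurrence along the parts of an inflation and to recognise a word as an inflation of its
-- segments. Only the existence of a decomposition is established. The equations are equalities of
-- sets whose unions may overlap, so one decomposition of each permutation is enough. The unknowns
-- form a closed family because a block of a block is a block: whatever a forbidden pattern leaves
-- inside a part is again a listed block. Taking every set of blocks at once makes the system
-- complete by construction, with no saturation process whose termination would have to be proved.

<ᵇ-true : ∀ {m n} → m < n → (m <ᵇ n) ≡ true
<ᵇ-true {m} {n} m<n with m <ᵇ n | <⇒<ᵇ m<n
... | true | _ = refl

<ᵇ-false : ∀ {m n} → ¬ m < n → (m <ᵇ n) ≡ false
<ᵇ-false {m} {n} m≮n with m <ᵇ n | <ᵇ⇒< m n
... | true  | lt = contradiction (lt _) m≮n
... | false | _  = refl

rank-++ : ∀ u v x → rank (u ++ v) x ≡ rank u x + rank v x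
rank-++ u v x = trans (cong length (filter-++ (_<? x) u v)) (length-++ (filter (_<? x) u))

rank-all : ∀ {w x} → All (_< x) w → rank w x ≡ length w
rank-all {x = x} p = cong length (filter-all (_<? x) p)

rank-none : ∀ {w x} → All (x <_) w → rank w x ≡ 0
rank-none {x = x} p = cong length (filter-none (_<? x) (All.map (λ x<y y<x → <-asym x<y y<x) p))

rank-↭ : ∀ {u v} x → u ↭ v → rank u x ≡ rank v x
rank-↭ x p = ↭-length (filter-↭ (_<? x) p)

rank-mono : ∀ w {x y} → x ≤ y → rank w x ≤ rank w y
rank-mono []      x≤y = z≤n
rank-mono (z ∷ w) {x} {y} x≤y with z <? x | z <? y
... | yes z<x | yes z<y rewrite <ᵇ-true z<x | <ᵇ-true z<y = s≤s (rank-mono w x≤y)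
... | yes z<x | no  z≮y = contradiction (<-≤-trans z<x x≤y) z≮y
... | no  z≮x | yes z<y rewrite <ᵇ-false z≮x | <ᵇ-true z<y = m≤n⇒m≤1+n (rank-mono w x≤y)
... | no  z≮x | no  z≮y rewrite <ᵇ-false z≮x | <ᵇ-false z≮y = rank-mono w x≤y

rank-strict : ∀ {w x y} → x ∈ w → x < y → rank w x < rank w y
rank-strict {z ∷ w} (here refl) x<y
  rewrite <ᵇ-true x<y | <ᵇ-false {z} (<-irrefl refl) = s≤s (rank-mono w (<⇒≤ x<y))
rank-strict {z ∷ w} {x} {y} (there x∈w) x<y with z <? x | z <? y
... | yes z<x | yes z<y rewrite <ᵇ-true z<x | <ᵇ-true z<y = s≤s (rank-strict x∈w x<y)
... | yes z<x | no  z≮y = contradiction (<-trans z<x x<y) z≮y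
... | no  z≮x | yes z<y rewrite <ᵇ-false z≮x | <ᵇ-true z<y = m≤n⇒m≤1+n (rank-strict x∈w x<y)
... | no  z≮x | no  z≮y rewrite <ᵇ-false z≮x | <ᵇ-false z≮y = rank-strict x∈w x<y

rank-upTo : ∀ n {x} → x ≤ n → rank (upTo n) x ≡ x
rank-upTo zero    z≤n = refl
rank-upTo (suc n) {x} x≤1+n = begin
  rank (upTo (suc n)) x            ≡⟨ cong (λ w → rank w x) (upTo-∷ʳ n) ⟨
  rank (upTo n ++ [ n ]) x         ≡⟨ rank-++ (upTo n) [ n ] x ⟩
  rank (upTo n) x + rank [ n ] x   ≡⟨ last (m≤n⇒m<n∨m≡n x≤1+n) ⟩
  x                                ∎
  where
  open ≡-Reasoning
  last : x < suc n ⊎ x ≡ suc n → rank (upTo n) x + rank [ n ] x ≡ x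
  last (inj₁ (s≤s x≤n)) rewrite <ᵇ-false (≤⇒≯ x≤n) = trans (+-identityʳ _) (rank-upTo n x≤n)
  last (inj₂ refl) rewrite <ᵇ-true (n<1+n n) = begin
    rank (upTo n) (suc n) + 1 ≡⟨ cong (_+ 1) (rank-all {upTo n} (All.tabulate (m<n⇒m<1+n ∘ ∈-upTo⁻))) ⟩
    length (upTo n) + 1       ≡⟨ cong (_+ 1) (length-upTo n) ⟩
    n + 1                     ≡⟨ +-comm n 1 ⟩
    suc n                     ∎

-- The condition is confined to the letters of `w` because `rank w` stands still between consecutive
-- letters.
StrictMonoOn : (ℕ → ℕ) → Word → Set
StrictMonoOn f w = ∀ {x y} → x ∈ w → y ∈ w → x < y → f x < f y

StrictMonoOn-<ᵇ : ∀ {f w} → StrictMonoOn f w → ∀ {x y} → x ∈ w → y ∈ w → (f x <ᵇ f y) ≡ (x <ᵇ y)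
StrictMonoOn-<ᵇ {f} mono {x} {y} x∈ y∈ with <-cmp x y
... | tri< x<y _ _ = trans (<ᵇ-true (mono x∈ y∈ x<y)) (sym (<ᵇ-true x<y))
... | tri≈ _ refl _ = trans (<ᵇ-false {f x} (<-irrefl refl)) (sym (<ᵇ-false {x} (<-irrefl refl)))
... | tri> x≮y _ y<x = trans (<ᵇ-false (<-asym (mono y∈ x∈ y<x))) (sym (<ᵇ-false x≮y))

rank-map : ∀ {f x} w → (∀ {y} → y ∈ w → (f y <ᵇ f x) ≡ (y <ᵇ x)) → rank (map f w) (f x) ≡ rank w x
rank-map [] _ = refl
rank-map {f} {x} (z ∷ w) h rewrite h (here refl) with z <ᵇ x
... | true  = cong suc (rank-map w (h ∘ there))
... | false = rank-map w (h ∘ there)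

std-map : ∀ {f w} → StrictMonoOn f w → std (map f w) ≡ std w
std-map {f} {w} mono = trans (sym (map-∘ w))
  (map-cong-local (All.tabulate λ x∈ → rank-map w (λ y∈ → StrictMonoOn-<ᵇ mono y∈ x∈)))

std-shift : ∀ c w → std (map (c +_) w) ≡ std w
std-shift c w = std-map (λ _ _ → +-monoʳ-< c)

length-std : ∀ w → length (std w) ≡ length w
length-std w = length-map (rank w) w

StrictMonoOn-rank : ∀ w → StrictMonoOn (rank w) w
StrictMonoOn-rank w x∈ _ = rank-strict x∈

-- Permutations

-- Pigeonhole: each entry of `xs` uses up its own entry of `ys`, and the length bound leaves nothing
-- over.
Unique-⊆⇒↭ : ∀ {A : Set} {xs ys : List A} → Unique xs → (∀ {x} → x ∈ xs → x ∈ ys) →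
             length ys ≤ length xs → xs ↭ ys
Unique-⊆⇒↭ {ys = []}    [] _ _ = ↭-refl
Unique-⊆⇒↭ {xs = x ∷ xs} (x∉ ∷ u) sub len with ∈-∃++ (sub (here refl))
... | us , vs , refl = ↭-trans (prep x (Unique-⊆⇒↭ u sub′ len′)) (↭-sym (shift x us vs))
  where
  sub′ : ∀ {y} → y ∈ xs → y ∈ us ++ vs
  sub′ y∈ with ∈-resp-↭ (shift x us vs) (sub (there y∈))
  ... | here refl = contradiction refl (All.lookup x∉ y∈)
  ... | there y∈′ = y∈′
  len′ : length (us ++ vs) ≤ length xs
  len′ = ≤-pred (subst (_≤ suc (length xs)) (↭-length (shift x us vs)) len)

Unique-resp-↭ : ∀ {A : Set} {xs ys : List A} → xs ↭ ys → Unique xs → Unique ys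
Unique-resp-↭ {A} p = ↭ₛ.Unique-resp-↭ (setoid A) (↭⇒↭ₛ p)

-- The form of "rearrangement of an interval of integers" that can be decided letter by letter.
Range : ℕ → Word → Set
Range a w = Unique w × All (λ x → a ≤ x × x < a + length w) w

↭⇒Range : ∀ {a w} → w ↭ map (a +_) (upTo (length w)) → Range a w
↭⇒Range {a} {w} p =
  Unique-resp-↭ (↭-sym p) (Unique.map⁺ (+-cancelˡ-≡ a _ _) (Unique.upTo⁺ _)) ,
  All-resp-↭ (↭-sym p) (All.tabulate bound)
  where
  bound : ∀ {x} → x ∈ map (a +_) (upTo (length w)) → a ≤ x × x < a + length w
  bound x∈ with ∈-map⁻ (a +_) x∈
  ... | i , i∈ , refl = m≤m+n a i , +-monoʳ-< a (∈-upTo⁻ i∈)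

Range⇒↭ : ∀ {a w} → Range a w → w ↭ map (a +_) (upTo (length w))
Range⇒↭ {a} {w} (u , bs) = Unique-⊆⇒↭ u sub
  (≤-reflexive (trans (length-map (a +_) (upTo (length w))) (length-upTo _)))
  where
  sub : ∀ {x} → x ∈ w → x ∈ map (a +_) (upTo (length w))
  sub {x} x∈ with All.lookup bs x∈
  ... | a≤x , x<a+n = subst (_∈ _) (m+[n∸m]≡n a≤x) (∈-map⁺ (a +_) (∈-upTo⁺ x∸a<n))
    where
    x∸a<n : x ∸ a < length w
    x∸a<n = +-cancelˡ-< a _ _ (subst (_< a + length w) (sym (m+[n∸m]≡n a≤x)) x<a+n)

IsPerm⇒Range : ∀ {w} → IsPerm w → Range 0 w
IsPerm⇒Range p = ↭⇒Range (↭-trans p (↭-reflexive (sym (map-id _))))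

Range⇒IsPerm : ∀ {w} → Range 0 w → IsPerm w
Range⇒IsPerm r = ↭-trans (Range⇒↭ r) (↭-reflexive (map-id _))

IsPerm⇒Unique : ∀ {w} → IsPerm w → Unique w
IsPerm⇒Unique = proj₁ ∘ IsPerm⇒Range

IsPerm⇒bounded : ∀ {w} → IsPerm w → All (_< length w) w
IsPerm⇒bounded = All.map proj₂ ∘ proj₂ ∘ IsPerm⇒Range

range? : ∀ a w → Dec (Range a w)
range? a w = unique? w ×-dec All.all? (λ x → (a ≤? x) ×-dec (x <? a + length w)) w
  where
  unique? : ∀ w → Dec (Unique w)
  unique? = AllPairs.allPairs? (λ x y → ¬? (x ≟ y))

isPerm? : Decidable IsPerm
isPerm? w = map′ Range⇒IsPerm IsPerm⇒Range (range? 0 w)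

consec? : Decidable Consec
consec? []      = yes (0 , ↭-refl)
-- The least value of a nonempty interval is itself a letter, so only letters are tried as base
-- point.
consec? (x ∷ w) = map′ from to (Any.any? (λ a → range? a (x ∷ w)) (x ∷ w))
  where
  from : Any (λ a → Range a (x ∷ w)) (x ∷ w) → Consec (x ∷ w)
  from p with find p
  ... | a , _ , r = a , Range⇒↭ r
  to : Consec (x ∷ w) → Any (λ a → Range a (x ∷ w)) (x ∷ w)
  to (a , p) = lose (∈-resp-↭ (↭-sym p) (here (sym (+-identityʳ a)))) (↭⇒Range p)

std-perm : ∀ {w} → IsPerm w → std w ≡ w
std-perm {w} p = map-id-local (All.map fixed (IsPerm⇒bounded p))
  where
  fixed : ∀ {x} → x < length w → rank w x ≡ x
  fixed x<n = trans (rank-↭ _ p) (rank-upTo _ (<⇒≤ x<n))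

rank-bounded : ∀ {w x} → x ∈ w → rank w x < length w
rank-bounded {w} {x} x∈ = filter-notAll (_<? x) w (Any.map (λ { refl → <-irrefl refl }) x∈)

StrictMonoOn⇒Unique : ∀ {f w} → StrictMonoOn f w → Unique w → Unique (map f w)
StrictMonoOn⇒Unique {w = []} mono [] = []
StrictMonoOn⇒Unique {f} {x ∷ w} mono (x∉ ∷ u) =
  All.map⁺ (All.tabulate λ y∈ → distinct (there y∈) (All.lookup x∉ y∈))
  ∷ StrictMonoOn⇒Unique (λ x∈ y∈ → mono (there x∈) (there y∈)) u
  where
  distinct : ∀ {y} → y ∈ x ∷ w → x ≢ y → f x ≢ f y
  distinct {y} y∈ x≢y with <-cmp x y
  ... | tri< x<y _ _ = <⇒≢ (mono (here refl) y∈ x<y)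
  ... | tri≈ _ x≡y _ = contradiction x≡y x≢y
  ... | tri> _ _ y<x = ≢-sym (<⇒≢ (mono y∈ (here refl) y<x))

IsPerm-std : ∀ {w} → Unique w → IsPerm (std w)
IsPerm-std {w} u = Range⇒IsPerm
  ( StrictMonoOn⇒Unique (StrictMonoOn-rank w) u
  , All.map⁺ (All.tabulate λ {x} x∈ → z≤n , subst (rank w x <_) (sym (length-std w)) (rank-bounded x∈)))

Unique-⊆ : ∀ {A : Set} {xs ys : List A} → xs ⊆ ys → Unique ys → Unique xs
Unique-⊆ []         []       = []
Unique-⊆ (_ ∷ʳ s)   (_ ∷ u)  = Unique-⊆ s u
Unique-⊆ (refl ∷ s) (x∉ ∷ u) = All.tabulate (λ y∈ → All.lookup x∉ (⊆.lookup s y∈)) ∷ Unique-⊆ s u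

-- Patterns

⊆-map⁻ : ∀ {f : ℕ → ℕ} {κ w} → κ ⊆ map f w → ∃[ κ′ ] (κ′ ⊆ w × κ ≡ map f κ′)
⊆-map⁻ {w = []}    [] = [] , [] , refl
⊆-map⁻ {w = x ∷ w} (_ ∷ʳ s) with ⊆-map⁻ s
... | κ′ , s′ , eq = κ′ , x ∷ʳ s′ , eq
⊆-map⁻ {f} {w = x ∷ w} (refl ∷ s) with ⊆-map⁻ s
... | κ′ , s′ , eq = x ∷ κ′ , refl ∷ s′ , cong (f x ∷_) eq

-- A subword of `std ρ` is the image of a subword of `ρ` under `rank ρ`, and standardisation does
-- not see an increasing relabelling.
≼-trans : ∀ {π τ σ} → π ≼ τ → τ ≼ σ → π ≼ σ
≼-trans (κ , κ⊆τ , refl) (ρ , ρ⊆σ , refl) with ⊆-map⁻ κ⊆τ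
... | κ′ , κ′⊆ρ , refl = κ′ , ⊆-trans κ′⊆ρ ρ⊆σ ,
      sym (std-map (λ x∈ y∈ → StrictMonoOn-rank ρ (⊆.lookup κ′⊆ρ x∈) (⊆.lookup κ′⊆ρ y∈)))

⊆-perm⇒≼ : ∀ {π σ} → IsPerm π → π ⊆ σ → π ≼ σ
⊆-perm⇒≼ p s = _ , s , std-perm p

≼-refl : ∀ {π} → IsPerm π → π ≼ π
≼-refl p = ⊆-perm⇒≼ p ⊆-refl

[]-≼ : ∀ σ → [] ≼ σ
[]-≼ σ = [] , ⊆.[]⊆-universal σ , refl

std-singleton : ∀ x → std [ x ] ≡ one
std-singleton x rewrite <ᵇ-false {x} (<-irrefl refl) = refl

one-≼ : ∀ {σ} → σ ≢ [] → one ≼ σ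
one-≼ {[]}    σ≢[] = contradiction refl σ≢[]
one-≼ {x ∷ σ} _ = [ x ] , refl ∷ ⊆.[]⊆-universal σ , std-singleton x

≼-one : ∀ {π} → π ≼ one → π ≡ [] ⊎ π ≡ one
≼-one (_ , (_ ∷ʳ []) , refl) = inj₁ refl
≼-one (_ , (refl ∷ []) , refl) = inj₂ refl

-- Inflation of labelled words

infix 4 _≪_ _⊑_ _≼L_

-- Pairing each label with its part keeps the two arguments of `inflate` equally long. Labels need
-- not form a permutation, since `offset` only compares them.
Labelled : Set
Labelled = List (ℕ × Word)

labels : Labelled → Word
labels = map proj₁

parts : Labelled → List Word
parts = map proj₂

inflateL : Labelled → Word
inflateL L = inflate (labels L) (parts L)

offsetL : Labelled → ℕ → ℕ
offsetL L = offset (labels L) (parts L)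

_≪_ : Word → Word → Set
s ≪ t = All (λ x → All (x <_) t) s

Sep : ℕ × Word → ℕ × Word → Set
Sep (p , s) (q , t) = (p < q × s ≪ t) ⊎ (q < p × t ≪ s)

Sep-sym : ∀ {a b} → Sep a b → Sep b a
Sep-sym (inj₁ x) = inj₂ x
Sep-sym (inj₂ x) = inj₁ x

≪-lookup : ∀ {s t x y} → s ≪ t → x ∈ s → y ∈ t → x < y
≪-lookup s≪t x∈ y∈ = All.lookup (All.lookup s≪t x∈) y∈

≪-intro : ∀ {s t} → (∀ {x y} → x ∈ s → y ∈ t → x < y) → s ≪ t
≪-intro h = All.tabulate λ x∈ → All.tabulate (h x∈)

rank-sep : ∀ {q t p s x} → Sep (q , t) (p , s) → x ∈ s →
           rank t x ≡ (if q <ᵇ p then length t else 0)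
rank-sep (inj₁ (q<p , t≪s)) x∈ rewrite <ᵇ-true q<p = rank-all (All.tabulate λ y∈ → ≪-lookup t≪s y∈ x∈)
rank-sep (inj₂ (p<q , s≪t)) x∈ rewrite <ᵇ-false (<-asym p<q) = rank-none (All.lookup s≪t x∈)

rank-sep-concat : ∀ {L p s x} → All (λ b → Sep b (p , s)) L → x ∈ s →
                  rank (concat (parts L)) x ≡ offsetL L p
rank-sep-concat [] x∈ = refl
rank-sep-concat {(q , t) ∷ L} {x = x} (sep ∷ seps) x∈ =
  trans (rank-++ t (concat (parts L)) x) (cong₂ _+_ (rank-sep sep x∈) (rank-sep-concat seps x∈))

rank-concat : ∀ {L p s x} → AllPairs Sep L → (p , s) ∈ L → x ∈ s →
              rank (concat (parts L)) x ≡ offsetL L p + rank s x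
rank-concat {(p , s) ∷ L} {x = x} (seps ∷ _) (here refl) x∈
  rewrite rank-++ s (concat (parts L)) x | <ᵇ-false {p} (<-irrefl refl)
  = trans (+-comm (rank s x) _) (cong (_+ rank s x) (rank-sep-concat (All.map Sep-sym seps) x∈))
rank-concat {(q , t) ∷ L} {p} {s} {x} (seps ∷ sepL) (there ps∈) x∈
  rewrite rank-++ t (concat (parts L)) x
  = trans (cong₂ _+_ (rank-sep (All.lookup seps ps∈) x∈) (rank-concat sepL ps∈ x∈))
          (sym (+-assoc (if q <ᵇ p then length t else 0) (offsetL L p) (rank s x)))

offset-cong : ∀ σ {ps qs} s → map length ps ≡ map length qs → offset σ ps s ≡ offset σ qs s
offset-cong []      s eq = refl
offset-cong (t ∷ σ) {[]} {[]} s eq = refl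
offset-cong (t ∷ σ) {p ∷ ps} {q ∷ qs} s eq =
  cong₂ _+_ (cong (if t <ᵇ s then_else 0) (∷-injectiveˡ eq)) (offset-cong σ {ps} {qs} s (∷-injectiveʳ eq))

zipWith-labelled : ∀ {C : Set} (f : ℕ → Word → C) (g : Word → Word) L →
  zipWith f (labels L) (map g (parts L)) ≡ map (λ ps → f (proj₁ ps) (g (proj₂ ps))) L
zipWith-labelled f g []      = refl
zipWith-labelled f g (_ ∷ L) = cong (_ ∷_) (zipWith-labelled f g L)

inflate-labelled : ∀ (g : Word → Word) (L : Labelled) → (∀ w → length (g w) ≡ length w) →
  inflate (labels L) (map g (parts L)) ≡ concat (map (λ ps → map (offsetL L (proj₁ ps) +_) (g (proj₂ ps))) L)
inflate-labelled g L len = cong concat (trans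
  (zipWith-labelled (λ s p → map (offset (labels L) (map g (parts L)) s +_) p) g L)
  (map-cong (λ ps → cong (λ o → map (o +_) (g (proj₂ ps)))
     (offset-cong (labels L) (proj₁ ps) (trans (sym (map-∘ (parts L))) (map-cong len (parts L))))) L))

-- Below an entry of `s` lie all entries of every word with a smaller label and none of a word with
-- a larger one. Its rank is therefore the offset of its label plus its rank inside `s`.
std-concat : ∀ {L} → AllPairs Sep L → std (concat (parts L)) ≡ inflate (labels L) (map std (parts L))
std-concat {L} sep = begin
  map (rank w) w                                    ≡⟨ concat-map (parts L) ⟨
  concat (map (map (rank w)) (parts L))             ≡⟨ cong concat (map-∘ L) ⟨
  concat (map (map (rank w) ∘ proj₂) L)             ≡⟨ cong concat (map-cong-local (All.tabulate step)) ⟩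
  concat (map (λ ps → map (offsetL L (proj₁ ps) +_) (std (proj₂ ps))) L) ≡⟨ inflate-labelled std L length-std ⟨
  inflate (labels L) (map std (parts L))            ∎
  where
  open ≡-Reasoning
  w : Word
  w = concat (parts L)
  step : ∀ {ps} → ps ∈ L → map (rank w) (proj₂ ps) ≡ map (offsetL L (proj₁ ps) +_) (std (proj₂ ps))
  step {p , s} ps∈ = trans (map-cong-local (All.tabulate (rank-concat sep ps∈))) (map-∘ s)

-- The shift is a separate argument because the subwords chosen inside `L` must be moved by the
-- offsets of `L`, not by their own.
shiftParts : (ℕ → ℕ) → Labelled → Labelled
shiftParts f = map (λ ps → proj₁ ps , map (f (proj₁ ps) +_) (proj₂ ps))

labels-shift : ∀ f L → labels (shiftParts f L) ≡ labels L
labels-shift f L = sym (map-∘ L)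

parts-shift : ∀ f L → parts (shiftParts f L) ≡ map (λ ps → map (f (proj₁ ps) +_) (proj₂ ps)) L
parts-shift f L = sym (map-∘ L)

std-parts-shift : ∀ f L → map std (parts (shiftParts f L)) ≡ map std (parts L)
std-parts-shift f []            = refl
std-parts-shift f ((p , s) ∷ L) = cong₂ _∷_ (std-shift (f p) s) (std-parts-shift f L)

placed : Labelled → Labelled
placed L = shiftParts (offsetL L) L

inflateL-concat : ∀ L → inflateL L ≡ concat (parts (placed L))
inflateL-concat L = trans (cong (inflate (labels L)) (sym (map-id (parts L))))
  (trans (inflate-labelled id L (λ _ → refl)) (cong concat (sym (parts-shift (offsetL L) L))))

summand-mono : ∀ r n {p q} → p ≤ q → (if r <ᵇ p then n else 0) ≤ (if r <ᵇ q then n else 0)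
summand-mono r n {p} p≤q with r <? p
... | yes r<p rewrite <ᵇ-true r<p | <ᵇ-true (<-≤-trans r<p p≤q) = ≤-refl
... | no  r≮p rewrite <ᵇ-false r≮p = z≤n

offset-mono : ∀ L {p q} → p ≤ q → offsetL L p ≤ offsetL L q
offset-mono [] p≤q = z≤n
offset-mono ((r , t) ∷ L) p≤q = +-mono-≤ (summand-mono r (length t) p≤q) (offset-mono L p≤q)

-- The part `s` counts for `q` but not for `p`, and every other part counts for `q` at least as much
-- as for `p`. This room is what keeps the placed segments from overlapping.
offset-room : ∀ {L p s q} → (p , s) ∈ L → p < q → offsetL L p + length s ≤ offsetL L q
offset-room {(p , s) ∷ L} {q = q} (here refl) p<q
  rewrite <ᵇ-true p<q | <ᵇ-false {p} (<-irrefl refl)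
  = ≤-trans (≤-reflexive (+-comm (offsetL L p) (length s))) (+-monoʳ-≤ (length s) (offset-mono L (<⇒≤ p<q)))
offset-room {(r , t) ∷ L} {p} {s} {q} (there ps∈) p<q = ≤-trans
  (≤-reflexive (+-assoc (if r <ᵇ p then length t else 0) (offsetL L p) (length s)))
  (+-mono-≤ (summand-mono r (length t) (<⇒≤ p<q)) (offset-room ps∈ p<q))

AllPairs-∈ : ∀ {A : Set} {R Q : A → A → Set} {xs} → AllPairs Q xs →
             (∀ {x y} → x ∈ xs → y ∈ xs → Q x y → R x y) → AllPairs R xs
AllPairs-∈ []       h = []
AllPairs-∈ (q ∷ qs) h = All.tabulate (λ y∈ → h (here refl) (there y∈) (All.lookup q y∈))
                      ∷ AllPairs-∈ qs (λ x∈ y∈ → h (there x∈) (there y∈))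

Bounded : Labelled → Set
Bounded L = Unique (labels L) × All (λ ps → All (_< length (proj₂ ps)) (proj₂ ps)) L

placed-≪ : ∀ {L p s q t} → (p , s) ∈ L → All (_< length s) s → p < q →
           map (offsetL L p +_) s ≪ map (offsetL L q +_) t
placed-≪ {L} {p} {s} {q} {t} ps∈ bs p<q = ≪-intro below
  where
  below : ∀ {x y} → x ∈ map (offsetL L p +_) s → y ∈ map (offsetL L q +_) t → x < y
  below x∈ y∈ with ∈-map⁻ (offsetL L p +_) x∈ | ∈-map⁻ (offsetL L q +_) y∈
  ... | i , i∈ , refl | j , j∈ , refl =
    <-≤-trans (+-monoʳ-< (offsetL L p) (All.lookup bs i∈)) (≤-trans (offset-room ps∈ p<q) (m≤m+n _ j))

placed-sep : ∀ {L} → Bounded L → AllPairs Sep (placed L)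
placed-sep {L} (u , bs) = AllPairs.map⁺ (AllPairs-∈ (AllPairs.map⁻ u) sep)
  where
  sep : ∀ {a b} → a ∈ L → b ∈ L → proj₁ a ≢ proj₁ b →
        Sep (proj₁ a , map (offsetL L (proj₁ a) +_) (proj₂ a)) (proj₁ b , map (offsetL L (proj₁ b) +_) (proj₂ b))
  sep {p , s} {q , t} a∈ b∈ p≢q with <-cmp p q
  ... | tri< p<q _ _ = inj₁ (p<q , placed-≪ a∈ (All.lookup bs a∈) p<q)
  ... | tri≈ _ p≡q _ = contradiction p≡q p≢q
  ... | tri> _ _ q<p = inj₂ (q<p , placed-≪ b∈ (All.lookup bs b∈) q<p)

-- Patterns of an inflation

_⊑_ : Labelled → Labelled → Set
_⊑_ = Pointwise (λ a b → proj₁ a ≡ proj₁ b × proj₂ a ⊆ proj₂ b)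

⊑-labels : ∀ {K L} → K ⊑ L → labels K ≡ labels L
⊑-labels []              = refl
⊑-labels ((refl , _) ∷ K⊑L) = cong (_ ∷_) (⊑-labels K⊑L)

⊑-shift : ∀ {K L} f → K ⊑ L → shiftParts f K ⊑ shiftParts f L
⊑-shift f []                 = []
⊑-shift f ((refl , s) ∷ K⊑L) = (refl , ⊆.map⁺ _ s) ∷ ⊑-shift f K⊑L

⊑-shift⁻ : ∀ {M} f L → M ⊑ shiftParts f L → ∃[ K ] (K ⊑ L × M ≡ shiftParts f K)
⊑-shift⁻ f [] [] = [] , [] , refl
⊑-shift⁻ f ((p , s) ∷ L) ((refl , s⊆) ∷ M⊑) with ⊆-map⁻ s⊆ | ⊑-shift⁻ f L M⊑
... | κ , κ⊆s , refl | K , K⊑L , refl = (p , κ) ∷ K , (refl , κ⊆s) ∷ K⊑L , refl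

⊑-concat : ∀ {K L} → K ⊑ L → concat (parts K) ⊆ concat (parts L)
⊑-concat []              = []
⊑-concat ((_ , s) ∷ K⊑L) = ⊆.++⁺ s (⊑-concat K⊑L)

⊆-++⁻ : ∀ {A : Set} (xs : List A) {ys τ} → τ ⊆ xs ++ ys → ∃[ κ ] ∃[ ρ ] (κ ⊆ xs × ρ ⊆ ys × τ ≡ κ ++ ρ)
⊆-++⁻ [] s = [] , _ , [] , s , refl
⊆-++⁻ (x ∷ xs) (_ ∷ʳ s) with ⊆-++⁻ xs s
... | κ , ρ , κ⊆ , ρ⊆ , eq = κ , ρ , x ∷ʳ κ⊆ , ρ⊆ , eq
⊆-++⁻ (x ∷ xs) (refl ∷ s) with ⊆-++⁻ xs s
... | κ , ρ , κ⊆ , ρ⊆ , refl = x ∷ κ , ρ , refl ∷ κ⊆ , ρ⊆ , refl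

⊑-concat⁻ : ∀ L {τ} → τ ⊆ concat (parts L) → ∃[ K ] (K ⊑ L × τ ≡ concat (parts K))
⊑-concat⁻ [] [] = [] , [] , refl
⊑-concat⁻ ((p , s) ∷ L) τ⊆ with ⊆-++⁻ s τ⊆
... | κ , ρ , κ⊆s , ρ⊆ , refl with ⊑-concat⁻ L ρ⊆
...   | K , K⊑L , refl = (p , κ) ∷ K , (refl , κ⊆s) ∷ K⊑L , refl

⊑-Sep : ∀ {K L} → K ⊑ L → AllPairs Sep L → AllPairs Sep K
⊑-Sep [] [] = []
⊑-Sep ((refl , s⊆) ∷ K⊑L) (seps ∷ sepL) = all s⊆ K⊑L seps ∷ ⊑-Sep K⊑L sepL
  where
  all : ∀ {K L p κ s} → κ ⊆ s → K ⊑ L → All (Sep (p , s)) L → All (Sep (p , κ)) K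
  all κ⊆s [] [] = []
  all κ⊆s ((refl , ρ⊆t) ∷ K⊑L) (inj₁ (p<q , s≪t) ∷ seps) =
    inj₁ (p<q , ≪-intro (λ x∈ y∈ → ≪-lookup s≪t (⊆.lookup κ⊆s x∈) (⊆.lookup ρ⊆t y∈))) ∷ all κ⊆s K⊑L seps
  all κ⊆s ((refl , ρ⊆t) ∷ K⊑L) (inj₂ (q<p , t≪s) ∷ seps) =
    inj₂ (q<p , ≪-intro (λ y∈ x∈ → ≪-lookup t≪s (⊆.lookup ρ⊆t y∈) (⊆.lookup κ⊆s x∈))) ∷ all κ⊆s K⊑L seps

-- Deleting letters preserves separation, so `std-concat` applies to what remains, and the offsets
-- of `L` vanish under standardisation.
std-placed : ∀ {K L} → Bounded L → K ⊑ L →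
  std (concat (parts (shiftParts (offsetL L) K))) ≡ inflate (labels L) (map std (parts K))
std-placed {K} {L} b K⊑L = begin
  std (concat (parts K′))                     ≡⟨ std-concat (⊑-Sep (⊑-shift (offsetL L) K⊑L) (placed-sep b)) ⟩
  inflate (labels K′) (map std (parts K′))    ≡⟨ cong₂ inflate (trans (labels-shift (offsetL L) K) (⊑-labels K⊑L)) (std-parts-shift (offsetL L) K) ⟩
  inflate (labels L) (map std (parts K))      ∎
  where
  open ≡-Reasoning
  K′ : Labelled
  K′ = shiftParts (offsetL L) K

inflate-≼ : ∀ {K L} → Bounded L → K ⊑ L → inflate (labels L) (map std (parts K)) ≼ inflateL L
inflate-≼ {K} {L} b K⊑L =
  concat (parts (shiftParts (offsetL L) K)) ,
  subst (concat (parts (shiftParts (offsetL L) K)) ⊆_) (sym (inflateL-concat L)) (⊑-concat (⊑-shift (offsetL L) K⊑L)) ,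
  std-placed b K⊑L

inflate-≼⁻ : ∀ {L γ} → Bounded L → γ ≼ inflateL L → ∃[ K ] (K ⊑ L × γ ≡ inflate (labels L) (map std (parts K)))
inflate-≼⁻ {L} b (τ , τ⊆ , refl) with ⊑-concat⁻ (placed L) (subst (τ ⊆_) (inflateL-concat L) τ⊆)
... | M , M⊑ , refl with ⊑-shift⁻ (offsetL L) L M⊑
...   | K , K⊑L , refl = K , K⊑L , std-placed b K⊑L

Perms : Labelled → Set
Perms L = Unique (labels L) × All (IsPerm ∘ proj₂) L

Perms⇒Bounded : ∀ {L} → Perms L → Bounded L
Perms⇒Bounded = map₂ (All.map IsPerm⇒bounded)

std-parts : ∀ {L} → All (IsPerm ∘ proj₂) L → map std (parts L) ≡ parts L
std-parts []       = refl
std-parts (p ∷ ps) = cong₂ _∷_ (std-perm p) (std-parts ps)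

⊑-refl : ∀ L → L ⊑ L
⊑-refl []      = []
⊑-refl (_ ∷ L) = (refl , ⊆-refl) ∷ ⊑-refl L

-- By `std-placed` with `K` equal to `L`, the inflation is the standardisation of its placed
-- segments, whose letters are distinct.
IsPerm-inflateL : ∀ {L} → Perms L → IsPerm (inflateL L)
IsPerm-inflateL {L} (u , ps) = subst IsPerm
  (trans (std-placed b (⊑-refl L)) (cong (inflate (labels L)) (std-parts ps)))
  (IsPerm-std (Unique.concat⁺ (All.map⁺ (All.map⁺ (All.map (λ {a} → uniquePart {a}) ps)))
                              (AllPairs.map⁺ (AllPairs.map disjoint (placed-sep b)))))
  where
  b : Bounded L
  b = Perms⇒Bounded (u , ps)
  uniquePart : ∀ {a : ℕ × Word} → IsPerm (proj₂ a) → Unique (map (offsetL L (proj₁ a) +_) (proj₂ a))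
  uniquePart p = Unique.map⁺ (+-cancelˡ-≡ _ _ _) (IsPerm⇒Unique p)
  disjoint : ∀ {a b : ℕ × Word} → Sep a b → ∀ {x} → x ∈ proj₂ a × x ∈ proj₂ b → ⊥
  disjoint (inj₁ (_ , s≪t)) (x∈ , y∈) = <-irrefl refl (≪-lookup s≪t x∈ y∈)
  disjoint (inj₂ (_ , t≪s)) (x∈ , y∈) = <-irrefl refl (≪-lookup t≪s y∈ x∈)

inflateL-segment : ∀ {L p s} → (p , s) ∈ L →
  ∃[ pre ] ∃[ suf ] inflateL L ≡ pre ++ map (offsetL L p +_) s ++ suf
inflateL-segment {L} ps∈
  with ∈-∃++ (∈-map⁺ proj₂ (∈-map⁺ (λ ps → proj₁ ps , map (offsetL L (proj₁ ps) +_) (proj₂ ps)) ps∈))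
... | us , vs , eq = concat us , concat vs ,
      trans (inflateL-concat L) (trans (cong concat eq) (sym (concat-++ us _)))

part-≼ : ∀ {L p s} → Perms L → (p , s) ∈ L → s ≼ inflateL L
part-≼ {L} {p} {s} (_ , ps) ps∈ with inflateL-segment ps∈
... | pre , suf , eq = map (offsetL L p +_) s ,
      subst (map (offsetL L p +_) s ⊆_) (sym eq) (⊆.++⁺ˡ pre (⊆.++⁺ʳ suf ⊆-refl)) ,
      trans (std-shift _ s) (std-perm (All.lookup ps ps∈))

map≡[] : ∀ {A B : Set} {f : A → B} xs → map f xs ≡ [] → xs ≡ []
map≡[] [] _ = refl

part-NormBlock : ∀ {L p s} → Perms L → (p , s) ∈ L → s ≢ [] → NormBlock s (inflateL L)
part-NormBlock {L} {p} {s} (_ , ps) ps∈ s≢[] with inflateL-segment ps∈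
... | pre , suf , eq = pre , map (offsetL L p +_) s , suf , eq , nonempty ,
      (offsetL L p , subst (λ n → map (offsetL L p +_) s ↭ map (offsetL L p +_) (upTo n)) (sym (length-map (offsetL L p +_) s)) (↭.map⁺ (offsetL L p +_) isPerm)) ,
      sym (trans (std-shift _ s) (std-perm isPerm))
  where
  isPerm : IsPerm s
  isPerm = All.lookup ps ps∈
  nonempty : map (offsetL L p +_) s ≢ []
  nonempty = s≢[] ∘ map≡[] s

_≼L_ : Labelled → Labelled → Set
_≼L_ = Pointwise (λ a b → proj₁ a ≡ proj₁ b × proj₂ a ≼ proj₂ b)

≼L⇒⊑ : ∀ {K L} → K ≼L L → ∃[ M ] (M ⊑ L × labels K ≡ labels L × map std (parts M) ≡ parts K)
≼L⇒⊑ [] = [] , [] , refl , refl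
≼L⇒⊑ {(p , _) ∷ _} ((refl , κ , κ⊆s , refl) ∷ K≼L) with ≼L⇒⊑ K≼L
... | M , M⊑L , eq₁ , eq₂ = (p , κ) ∷ M , (refl , κ⊆s) ∷ M⊑L , cong (p ∷_) eq₁ , cong (std κ ∷_) eq₂

inflateL-mono : ∀ {K L} → Perms L → K ≼L L → inflateL K ≼ inflateL L
inflateL-mono {K} {L} ps K≼L with ≼L⇒⊑ K≼L
... | M , M⊑L , eq₁ , eq₂ = subst (_≼ inflateL L)
      (cong₂ inflate (sym eq₁) eq₂) (inflate-≼ (Perms⇒Bounded ps) M⊑L)

stdParts : Labelled → Labelled
stdParts = map (map₂ std)

⊑⇒≼L : ∀ {K L} → K ⊑ L → stdParts K ≼L L
⊑⇒≼L []                      = []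
⊑⇒≼L ((refl , κ⊆s) ∷ K⊑L) = (refl , _ , κ⊆s , refl) ∷ ⊑⇒≼L K⊑L

Perms-stdParts : ∀ {K L} → Perms L → K ⊑ L → Perms (stdParts K)
Perms-stdParts {K} {L} (u , ps) K⊑L =
  subst Unique (sym (trans (sym (map-∘ K)) (⊑-labels K⊑L))) u , All.map⁺ (perms K⊑L ps)
  where
  perms : ∀ {K L} → K ⊑ L → All (IsPerm ∘ proj₂) L → All (IsPerm ∘ std ∘ proj₂) K
  perms []                 []       = []
  perms ((_ , κ⊆s) ∷ K⊑L) (p ∷ ps) = IsPerm-std (Unique-⊆ κ⊆s (IsPerm⇒Unique p)) ∷ perms K⊑L ps

-- Empty parts are kept in `K`, so that it has the same labels as `L` and the two can be compared
-- position by position.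
≼-inflateL⁻ : ∀ {L γ} → Perms L → γ ≼ inflateL L → ∃[ K ] (Perms K × K ≼L L × γ ≡ inflateL K)
≼-inflateL⁻ {L} ps γ≼ with inflate-≼⁻ (Perms⇒Bounded ps) γ≼
... | K , K⊑L , refl = stdParts K , Perms-stdParts ps K⊑L , ⊑⇒≼L K⊑L ,
      cong₂ inflate (trans (sym (⊑-labels K⊑L)) (map-∘ K)) (trans (sym (map-∘ K)) (map-∘ K))

ones : Labelled → Labelled
ones = map (λ a → proj₁ a , one)

inflate-ones : ∀ {L} → Unique (labels L) → inflateL (ones L) ≡ std (labels L)
inflate-ones {L} u = begin
  inflateL (ones L)                           ≡⟨ cong₂ inflate eq₁ eq₂ ⟩
  inflate (labels M) (map std (parts M))      ≡⟨ std-concat sep ⟨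
  std (concat (parts M))                      ≡⟨ cong std (cong concat (sym (map-∘ (labels L)))) ⟩
  std (concat (map [_] (labels L)))           ≡⟨ cong std concat-map-[ labels L ] ⟩
  std (labels L)                              ∎
  where
  open ≡-Reasoning
  M : Labelled
  M = map (λ p → p , [ p ]) (labels L)
  eq₁ : labels (ones L) ≡ labels M
  eq₁ = trans (sym (map-∘ L)) (trans (map-∘ {g = id} L) (map-∘ (labels L)))
  eq₂ : parts (ones L) ≡ map std (parts M)
  eq₂ = begin
    parts (ones L)                            ≡⟨ map-∘ L ⟨
    map (λ _ → one) L                         ≡⟨ map-cong (λ a → std-singleton (proj₁ a)) L ⟨
    map (λ a → std [ proj₁ a ]) L             ≡⟨ map-∘ L ⟩
    map (λ p → std [ p ]) (labels L)          ≡⟨ map-∘ (labels L) ⟩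
    map (λ a → std (proj₂ a)) M               ≡⟨ map-∘ M ⟩
    map std (parts M)                         ∎
  sep : AllPairs Sep M
  sep = AllPairs.map⁺ (AllPairs.map distinct u)
    where
    distinct : ∀ {p q} → p ≢ q → Sep (p , [ p ]) (q , [ q ])
    distinct {p} {q} p≢q with <-cmp p q
    ... | tri< p<q _ _ = inj₁ (p<q , (p<q ∷ []) ∷ [])
    ... | tri≈ _ p≡q _ = contradiction p≡q p≢q
    ... | tri> _ _ q<p = inj₂ (q<p , (q<p ∷ []) ∷ [])

Perms-ones : ∀ {L} → Unique (labels L) → Perms (ones L)
Perms-ones {L} u = subst Unique (map-∘ L) u , All.map⁺ (All.universal (λ _ → ↭-refl) L)

-- Each nonempty part contains `one`, and inflating the labels by ones returns the labels.
labels-≼ : ∀ {L} → Perms L → IsPerm (labels L) → All (λ a → proj₂ a ≢ []) L → labels L ≼ inflateL L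
labels-≼ {L} ps perm ne = subst (_≼ inflateL L)
  (trans (inflate-ones (proj₁ ps)) (std-perm perm)) (inflateL-mono ps (below ne))
  where
  below : ∀ {L} → All (λ a → proj₂ a ≢ []) L → ones L ≼L L
  below []       = []
  below (p ∷ ps) = (refl , one-≼ p) ∷ below ps

-- Simple patterns of an inflation

NormBlock-Simple : ∀ {ρ γ} → Simple ρ → NormBlock γ ρ → length γ ≡ 1 ⊎ γ ≡ ρ
NormBlock-Simple (perm , _ , intervals) (pre , mid , suf , eq , mid≢[] , c , refl)
  with intervals pre mid suf eq mid≢[] c
... | inj₁ one = inj₁ (trans (length-std mid) one)
... | inj₂ (refl , refl) =
  inj₂ (trans (cong std (trans (sym (++-identityʳ mid)) (sym eq))) (std-perm perm))

1≤length⇒≢[] : ∀ {A : Set} {xs : List A} → 1 ≤ length xs → xs ≢ []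
1≤length⇒≢[] () refl

≼L-lookup : ∀ {K L p γ} → K ≼L L → (p , γ) ∈ K → Any (λ a → γ ≼ proj₂ a) L
≼L-lookup ((_ , γ≼) ∷ _) (here refl) = here γ≼
≼L-lookup (_ ∷ K≼L)      (there γ∈)  = there (≼L-lookup K≼L γ∈)

-- The parts of ρ inside the parts of L are blocks of ρ, hence ρ itself or of size at most 1.
simple-≼-inflateL : ∀ {L ρ} → Perms L → Simple ρ → ρ ≼ inflateL L →
                    ρ ≼ labels L ⊎ Any (λ a → ρ ≼ proj₂ a) L
simple-≼-inflateL {L} ps simple ρ≼ with ≼-inflateL⁻ ps ρ≼
... | K , psK , K≼L , refl with Any.any? (λ a → 2 ≤? length (proj₂ a)) K
...   | yes big with find big
...     | (p , γ) , γ∈ , 2≤γ with NormBlock-Simple simple (part-NormBlock psK γ∈ (1≤length⇒≢[] (<⇒≤ 2≤γ)))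
...       | inj₁ 1≡γ = contradiction 2≤γ (<⇒≱ (≤-reflexive (cong suc 1≡γ)))
...       | inj₂ γ≡ρ = inj₂ (subst (λ ρ → Any (λ a → ρ ≼ proj₂ a) L) γ≡ρ (≼L-lookup K≼L γ∈))
simple-≼-inflateL {L} ps simple ρ≼ | K , (_ , psK) , K≼L , refl | no small =
  inj₁ (≼-trans (subst (inflateL K ≼_) (inflate-ones (proj₁ ps))
                       (inflateL-mono (Perms-ones (proj₁ ps)) (below K≼L psK (All.¬Any⇒All¬ K small))))
                (labels L , ⊆-refl , refl))
  where
  ≼one : ∀ {γ} → IsPerm γ → ¬ 2 ≤ length γ → γ ≼ one
  ≼one {[]}        _ _ = []-≼ one
  ≼one {x ∷ []}    p _ = [ 0 ] , ⊆-refl , trans (sym (std-singleton x)) (std-perm p)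
  ≼one {_ ∷ _ ∷ _} _ s = contradiction (s≤s (s≤s z≤n)) s
  below : ∀ {K L} → K ≼L L → All (IsPerm ∘ proj₂) K → All (λ a → ¬ 2 ≤ length (proj₂ a)) K → K ≼L ones L
  below []               []       []       = []
  below ((eq , _) ∷ K≼L) (p ∷ ps) (s ∷ ss) = (eq , ≼one p s) ∷ below K≼L ps ss

-- Factors of a word

splits : ∀ {A : Set} → List A → List (List A × List A)
splits []       = [ [] , [] ]
splits (x ∷ xs) = ([] , x ∷ xs) ∷ map (map₁ (x ∷_)) (splits xs)

∈-splits⁺ : ∀ {A : Set} (us vs : List A) → (us , vs) ∈ splits (us ++ vs)
∈-splits⁺ []       []       = here refl
∈-splits⁺ []       (v ∷ vs) = here refl
∈-splits⁺ (u ∷ us) vs       = there (∈-map⁺ (map₁ (u ∷_)) (∈-splits⁺ us vs))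

∈-splits⁻ : ∀ {A : Set} {us vs : List A} xs → (us , vs) ∈ splits xs → xs ≡ us ++ vs
∈-splits⁻ []       (here refl) = refl
∈-splits⁻ (x ∷ xs) (here refl) = refl
∈-splits⁻ (x ∷ xs) (there p) with ∈-map⁻ (map₁ (x ∷_)) p
... | _ , q , refl = cong (x ∷_) (∈-splits⁻ xs q)

factors : ∀ {A : Set} → List A → List (List A × List A × List A)
factors xs = concatMap (λ uv → map (proj₁ uv ,_) (splits (proj₂ uv))) (splits xs)

∈-factors⁺ : ∀ {A : Set} (pre mid suf : List A) → (pre , mid , suf) ∈ factors (pre ++ mid ++ suf)
∈-factors⁺ pre mid suf = ∈-concatMap⁺ _
  (lose (∈-splits⁺ pre (mid ++ suf)) (∈-map⁺ (pre ,_) (∈-splits⁺ mid suf)))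

∈-factors⁻ : ∀ {A : Set} {pre mid suf : List A} xs → (pre , mid , suf) ∈ factors xs → xs ≡ pre ++ mid ++ suf
∈-factors⁻ xs p with find (∈-concatMap⁻ (λ uv → map (proj₁ uv ,_) (splits (proj₂ uv))) p)
... | (us , vs) , uv∈ , q with ∈-map⁻ (us ,_) q
...   | _ , r , refl = trans (∈-splits⁻ xs uv∈) (cong (us ++_) (∈-splits⁻ vs r))

null? : ∀ {A : Set} (xs : List A) → Dec (xs ≡ [])
null? []      = yes refl
null? (_ ∷ _) = no λ ()

TrivialFactor : Word × Word × Word → Set
TrivialFactor (pre , mid , suf) = mid ≢ [] → Consec mid → length mid ≡ 1 ⊎ (pre ≡ [] × suf ≡ [])

trivialFactor? : Decidable TrivialFactor
trivialFactor? (pre , mid , suf) =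
  ¬? (null? mid) →-dec (consec? mid →-dec ((length mid ≟ 1) ⊎-dec (null? pre ×-dec null? suf)))

simple? : Decidable Simple
simple? σ = isPerm? σ ×-dec ((4 ≤? length σ) ×-dec map′
  (λ { trivial pre mid suf refl → All.lookup trivial (∈-factors⁺ pre mid suf) })
  (λ trivial → All.tabulate (λ {f} f∈ → trivial _ _ _ (∈-factors⁻ σ f∈)))
  (All.all? trivialFactor? (factors σ)))

-- Substitution decomposition

offset-map : ∀ {f s} π ps → (∀ {t} → t ∈ π → (f t <ᵇ f s) ≡ (t <ᵇ s)) → offset (map f π) ps (f s) ≡ offset π ps s
offset-map []      ps       h = refl
offset-map (t ∷ π) []       h = refl
offset-map (t ∷ π) (p ∷ ps) h =
  cong₂ _+_ (cong (if_then length p else 0) (h (here refl))) (offset-map π ps (h ∘ there))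

-- `offset` sees the labels only through comparisons, so any word in the same relative order serves.
inflate-map : ∀ {f π} ps → StrictMonoOn f π → inflate (map f π) ps ≡ inflate π ps
inflate-map {f} {π} ps mono = cong concat
  (zipWith-map-local π ps λ {s} {p} s∈ → cong (λ o → map (o +_) p) (offset-map π ps (λ t∈ → StrictMonoOn-<ᵇ mono t∈ s∈)))
  where
  zipWith-map-local : ∀ {C : Set} {g h : ℕ → Word → C} σ ps → (∀ {s p} → s ∈ σ → g (f s) p ≡ h s p) →
                zipWith g (map f σ) ps ≡ zipWith h σ ps
  zipWith-map-local []      ps       eq = refl
  zipWith-map-local (s ∷ σ) []       eq = refl
  zipWith-map-local (s ∷ σ) (p ∷ ps) eq = cong₂ _∷_ (eq (here refl)) (zipWith-map-local σ ps (eq ∘ there))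

-- Segments of a word and their quotient

Apart : Word → Word → Set
Apart s t = s ≪ t ⊎ t ≪ s

Apart-sym : ∀ {s t} → Apart s t → Apart t s
Apart-sym (inj₁ s≪t) = inj₂ s≪t
Apart-sym (inj₂ t≪s) = inj₁ t≪s

apart? : ∀ s t → Dec (Apart s t)
apart? s t = ≪? s t ⊎-dec ≪? t s
  where
  ≪? : ∀ s t → Dec (s ≪ t)
  ≪? s t = All.all? (λ x → All.all? (x <?_) t) s

-- Junk value 0 on the empty word.
hd : Word → ℕ
hd []      = 0
hd (x ∷ _) = x

hd-∈ : ∀ {s} → s ≢ [] → hd s ∈ s
hd-∈ {[]}    s≢[] = contradiction refl s≢[]
hd-∈ {x ∷ s} _    = here refl

≪-hd : ∀ {s t} → s ≢ [] → t ≢ [] → s ≪ t → hd s < hd t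
≪-hd s≢[] t≢[] s≪t = ≪-lookup s≪t (hd-∈ s≢[]) (hd-∈ t≢[])

NonEmpty : List Word → Set
NonEmpty = All (_≢ [])

-- When segments are pairwise apart, any choice of representatives shows their relative order; the
-- first letters are used.
quotient : List Word → Labelled
quotient segs = map (λ s → rank (map hd segs) (hd s) , std s) segs

labels-quotient : ∀ segs → labels (quotient segs) ≡ std (map hd segs)
labels-quotient segs = trans (sym (map-∘ segs)) (map-∘ segs)

inflateL-quotient : ∀ {segs} → NonEmpty segs → AllPairs Apart segs → inflateL (quotient segs) ≡ std (concat segs)
inflateL-quotient {segs} ne ap = begin
  inflateL (quotient segs)                                 ≡⟨ cong₂ inflate (labels-quotient segs) (sym (map-∘ segs)) ⟩
  inflate (std (map hd segs)) (map std segs)               ≡⟨ inflate-map (map std segs) (StrictMonoOn-rank (map hd segs)) ⟩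
  inflate (map hd segs) (map std segs)                     ≡⟨ cong₂ inflate (map-∘ segs) (cong (map std) segs≡) ⟩
  inflate (labels L) (map std (parts L))                   ≡⟨ std-concat sep ⟨
  std (concat (parts L))                                   ≡⟨ cong (std ∘ concat) segs≡ ⟨
  std (concat segs)                                        ∎
  where
  open ≡-Reasoning
  L : Labelled
  L = map (λ s → hd s , s) segs
  segs≡ : segs ≡ parts L
  segs≡ = trans (sym (map-id segs)) (map-∘ segs)
  sep : AllPairs Sep L
  sep = AllPairs.map⁺ (AllPairs-∈ ap λ s∈ t∈ →
    [ (λ s≪t → inj₁ (≪-hd (All.lookup ne s∈) (All.lookup ne t∈) s≪t , s≪t))
    , (λ t≪s → inj₂ (≪-hd (All.lookup ne t∈) (All.lookup ne s∈) t≪s , t≪s)) ]′)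

∈⇒⊆concat : ∀ {A : Set} {xs : List A} {xss} → xs ∈ xss → xs ⊆ concat xss
∈⇒⊆concat {xss = xs ∷ xss} (here refl) = ⊆.++⁺ʳ (concat xss) ⊆-refl
∈⇒⊆concat {xss = ys ∷ xss} (there p)   = ⊆.++⁺ˡ ys (∈⇒⊆concat p)

length-concat-≥ : ∀ {segs} → NonEmpty segs → length segs ≤ length (concat segs)
length-concat-≥ [] = z≤n
length-concat-≥ {[] ∷ segs} (ne ∷ nes) = contradiction refl ne
length-concat-≥ {(x ∷ s) ∷ segs} (ne ∷ nes) = s≤s (≤-trans (length-concat-≥ nes)
  (≤-trans (m≤n+m _ (length s)) (≤-reflexive (sym (length-++ s)))))

-- Every segment other than `s` contributes at least one letter; the `suc` appears because
-- `length segs` also counts `s`. With two segments or more, each is strictly shorter than the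
-- whole, which is what makes recursion on the parts possible.
length-segment : ∀ {segs s} → NonEmpty segs → s ∈ segs → length s + length segs ≤ suc (length (concat segs))
length-segment {s ∷ segs} (_ ∷ nes) (here refl) = begin
  length s + suc (length segs)          ≡⟨ +-suc (length s) (length segs) ⟩
  suc (length s + length segs)          ≤⟨ s≤s (+-monoʳ-≤ (length s) (length-concat-≥ nes)) ⟩
  suc (length s + length (concat segs)) ≡⟨ cong suc (length-++ s) ⟨
  suc (length (s ++ concat segs))       ∎
  where open ≤-Reasoning
length-segment {[] ∷ segs} (ne ∷ nes) (there s∈) = contradiction refl ne
length-segment {(x ∷ t) ∷ segs} {s} (_ ∷ nes) (there s∈) = begin
  length s + suc (length segs)                ≡⟨ +-suc (length s) (length segs) ⟩
  suc (length s + length segs)                ≤⟨ s≤s (length-segment nes s∈) ⟩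
  suc (suc (length (concat segs)))            ≤⟨ s≤s (s≤s (m≤n+m _ (length t))) ⟩
  suc (suc (length t + length (concat segs))) ≡⟨ cong (suc ∘ suc) (length-++ t) ⟨
  suc (suc (length (t ++ concat segs)))       ∎
  where open ≤-Reasoning

Root : Word → Set
Root π = π ≡ oplus ⊎ π ≡ ominus ⊎ Simple π

Decomposition : Word → Set
Decomposition σ = ∃[ L ] (Root (labels L) × Perms L ×
  All (λ a → proj₂ a ≢ [] × length (proj₂ a) < length σ) L × σ ≡ inflateL L)

Unique-hd : ∀ {segs} → NonEmpty segs → AllPairs Apart segs → Unique (map hd segs)
Unique-hd ne ap = AllPairs.map⁺ (AllPairs-∈ ap λ s∈ t∈ →
  [ (λ s≪t → <⇒≢ (≪-hd (All.lookup ne s∈) (All.lookup ne t∈) s≪t))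
  , (λ t≪s → ≢-sym (<⇒≢ (≪-hd (All.lookup ne t∈) (All.lookup ne s∈) t≪s))) ]′)

quotient-decomposition : ∀ {segs} → IsPerm (concat segs) → NonEmpty segs → AllPairs Apart segs →
  2 ≤ length segs → Root (labels (quotient segs)) → Decomposition (concat segs)
quotient-decomposition {segs} perm ne ap 2≤ root = quotient segs , root ,
  ( subst Unique (sym (labels-quotient segs)) (IsPerm⇒Unique (IsPerm-std (Unique-hd ne ap)))
  , All.map⁺ (All.tabulate λ s∈ → IsPerm-std (Unique-⊆ (∈⇒⊆concat s∈) (IsPerm⇒Unique perm)))) ,
  All.map⁺ (All.tabulate λ {s} s∈ → All.lookup ne s∈ ∘ map≡[] s , shorter s∈) ,
  sym (trans (inflateL-quotient ne ap) (std-perm perm))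
  where
  shorter : ∀ {s} → s ∈ segs → length (std s) < length (concat segs)
  shorter {s} s∈ = subst (_< length (concat segs)) (sym (length-std s)) (≤-pred (begin
    suc (suc (length s))       ≡⟨ +-comm 2 (length s) ⟩
    length s + 2               ≤⟨ +-monoʳ-≤ (length s) 2≤ ⟩
    length s + length segs     ≤⟨ length-segment ne s∈ ⟩
    suc (length (concat segs)) ∎))
    where open ≤-Reasoning

AllPairs-resp-↭ : ∀ {A : Set} {R : A → A → Set} {xs ys} → (∀ {x y} → R x y → R y x) →
                  xs ↭ ys → AllPairs R xs → AllPairs R ys
AllPairs-resp-↭ {A} {R} R-sym p = ↭ₛ.AllPairs-resp-↭ (setoid A) R-sym (resp₂ R) (↭⇒↭ₛ p)

AllPairs-++⁻ʳ : ∀ {A : Set} {R : A → A → Set} xs {ys} → AllPairs R (xs ++ ys) → AllPairs R ys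
AllPairs-++⁻ʳ []       ap       = ap
AllPairs-++⁻ʳ (_ ∷ xs) (_ ∷ ap) = AllPairs-++⁻ʳ xs ap

AllPairs-cross : ∀ {A : Set} {R : A → A → Set} {xs ys x y} → AllPairs R (xs ++ ys) → x ∈ xs → y ∈ ys → R x y
AllPairs-cross {xs = _ ∷ xs} (r ∷ _)  (here refl) y∈ = All.lookup r (∈-++⁺ʳ xs y∈)
AllPairs-cross               (_ ∷ ap) (there x∈)  y∈ = AllPairs-cross ap x∈ y∈

-- At least two segments in the run make the list shorter after merging; at least one outside it
-- leaves two segments. Apartness from the union keeps the segments pairwise apart.
Mergeable : List Word × List Word × List Word → Set
Mergeable (pre , mid , suf) =
  2 ≤ length mid × 1 ≤ length (pre ++ suf) × All (λ s → Apart s (concat mid)) (pre ++ suf)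

mergeable? : Decidable Mergeable
mergeable? (pre , mid , suf) =
  (2 ≤? length mid) ×-dec ((1 ≤? length (pre ++ suf)) ×-dec All.all? (λ s → apart? s (concat mid)) (pre ++ suf))

concat≢[] : ∀ {segs : List Word} → NonEmpty segs → 1 ≤ length segs → concat segs ≢ []
concat≢[] ne 1≤ = 1≤length⇒≢[] (≤-trans 1≤ (length-concat-≥ ne))

-- The labels of a proper interval with two or more elements fill a range of integers. Every other
-- label is below or above that range, so its segment is below or above the union of the run, and
-- the run would be mergeable.
simple-quotient : ∀ {segs} → NonEmpty segs → AllPairs Apart segs → 4 ≤ length segs →
  ¬ Any Mergeable (factors segs) → Simple (labels (quotient segs))
simple-quotient {segs} ne ap 4≤ ¬merge =
  subst IsPerm (sym (labels-quotient segs)) (IsPerm-std (Unique-hd ne ap)) ,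
  subst (4 ≤_) (sym (trans (cong length labels≡) (length-map f segs))) 4≤ ,
  intervals
  where
  f : Word → ℕ
  f s = rank (map hd segs) (hd s)

  labels≡ : labels (quotient segs) ≡ map f segs
  labels≡ = sym (map-∘ segs)

  mono : ∀ {s t} → s ∈ segs → t ∈ segs → s ≪ t → f s < f t
  mono s∈ t∈ s≪t = rank-strict (∈-map⁺ hd s∈) (≪-hd (All.lookup ne s∈) (All.lookup ne t∈) s≪t)

  reflects : ∀ {s t} → s ∈ segs → t ∈ segs → Apart s t → f s < f t → s ≪ t
  reflects s∈ t∈ (inj₁ s≪t) _ = s≪t
  reflects s∈ t∈ (inj₂ t≪s) r = contradiction r (<-asym (mono t∈ s∈ t≪s))

  map-++⁻ : ∀ (us : Word) {vs} xs → map f xs ≡ us ++ vs →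
            ∃[ ys ] ∃[ zs ] (xs ≡ ys ++ zs × map f ys ≡ us × map f zs ≡ vs)
  map-++⁻ []       xs       eq   = [] , xs , refl , refl , eq
  map-++⁻ (u ∷ us) (x ∷ xs) eq with map-++⁻ us xs (∷-injectiveʳ eq)
  ... | ys , zs , refl , refl , refl = x ∷ ys , zs , refl , cong (_∷ map f ys) (∷-injectiveˡ eq) , refl

  merge : ∀ pre mid suf → segs ≡ pre ++ mid ++ suf → Consec (map f mid) → 2 ≤ length mid →
          1 ≤ length (pre ++ suf) → ⊥
  merge pre mid suf refl (a , p) 2≤ 1≤ = ¬merge (lose (∈-factors⁺ pre mid suf)
    (2≤ , 1≤ , All.tabulate apart))
    where
    rearrange : pre ++ mid ++ suf ↭ mid ++ pre ++ suf
    rearrange = shifts pre mid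
    apart : ∀ {s} → s ∈ pre ++ suf → Apart s (concat mid)
    apart {s} s∈ = outside
      where
      range : Range a (map f mid)
      range = ↭⇒Range p
      s∈segs : s ∈ segs
      s∈segs = ∈-resp-↭ (↭-sym rearrange) (∈-++⁺ʳ mid s∈)
      m∈segs : ∀ {m} → m ∈ mid → m ∈ segs
      m∈segs m∈ = ∈-++⁺ʳ pre (∈-++⁺ˡ m∈)
      s-apart : ∀ {m} → m ∈ mid → Apart m s
      s-apart m∈ = AllPairs-cross (AllPairs-resp-↭ Apart-sym rearrange ap) m∈ s∈
      f-distinct : ∀ {m} → m ∈ mid → f s ≢ f m
      f-distinct m∈ with s-apart m∈
      ... | inj₁ m≪s = ≢-sym (<⇒≢ (mono (m∈segs m∈) s∈segs m≪s))
      ... | inj₂ s≪m = <⇒≢ (mono s∈segs (m∈segs m∈) s≪m)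
      -- Every value in the range is already the label of a segment of `mid`, and `s` shares its
      -- label with none of these.
      not-inside : a ≤ f s → f s < a + length (map f mid) → ⊥
      not-inside a≤ <a+n with ∈-map⁻ f (∈-resp-↭ (↭-sym p)
        (subst (_∈ map (a +_) (upTo (length (map f mid)))) (m+[n∸m]≡n a≤) (∈-map⁺ (a +_) (∈-upTo⁺
          (+-cancelˡ-< a _ _ (subst (_< a + length (map f mid)) (sym (m+[n∸m]≡n a≤)) <a+n))))))
      ... | m , m∈ , eq = f-distinct m∈ eq
      outside : Apart s (concat mid)
      outside with f s <? a
      ... | yes fs<a = inj₁ (≪-intro λ x∈ y∈ → case ∈-concat⁻′ mid y∈ of λ where
              (m , y∈m , m∈) → ≪-lookup (reflects s∈segs (m∈segs m∈) (Apart-sym (s-apart m∈))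
                (<-≤-trans fs<a (proj₁ (All.lookup (proj₂ range) (∈-map⁺ f m∈))))) x∈ y∈m)
      ... | no fs≮a = inj₂ (≪-intro λ y∈ x∈ → case ∈-concat⁻′ mid y∈ of λ where
              (m , y∈m , m∈) → ≪-lookup (reflects (m∈segs m∈) s∈segs (s-apart m∈)
                (<-≤-trans (proj₂ (All.lookup (proj₂ range) (∈-map⁺ f m∈)))
                           (≮⇒≥ (not-inside (≮⇒≥ fs≮a))))) y∈m x∈)

  intervals : ∀ pre mid suf → labels (quotient segs) ≡ pre ++ mid ++ suf → mid ≢ [] → Consec mid →
              length mid ≡ 1 ⊎ (pre ≡ [] × suf ≡ [])
  intervals pre mid suf eq mid≢[] c with map-++⁻ pre segs (trans (sym labels≡) eq)
  ... | pre′ , rest , eq₁ , refl , eq₂ with map-++⁻ mid rest eq₂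
  ...   | mid′ , suf′ , refl , refl , refl = cases mid′ refl pre′ suf′ refl refl
    where
    cases : ∀ ms → ms ≡ mid′ → ∀ us vs → us ≡ pre′ → vs ≡ suf′ →
            length (map f ms) ≡ 1 ⊎ (map f us ≡ [] × map f vs ≡ [])
    cases []          refl _ _ _ _ = contradiction refl mid≢[]
    cases (_ ∷ [])    _ _ _ _ _ = inj₁ refl
    cases (_ ∷ _ ∷ _) refl [] [] refl refl = inj₂ (refl , refl)
    cases ms@(_ ∷ _ ∷ _) refl us@(_ ∷ _) vs refl refl = ⊥-elim (merge us ms vs eq₁ c (s≤s (s≤s z≤n)) (s≤s z≤n))
    cases ms@(_ ∷ _ ∷ _) refl [] vs@(_ ∷ _) refl refl = ⊥-elim (merge [] ms vs eq₁ c (s≤s (s≤s z≤n)) (s≤s z≤n))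

std-oplus : ∀ {x y} → x < y → std (x ∷ y ∷ []) ≡ oplus
std-oplus {x} {y} x<y rewrite <ᵇ-false {x} (<-irrefl refl) | <ᵇ-true x<y
  | <ᵇ-false {y} (<-irrefl refl) | <ᵇ-false (<-asym x<y) = refl

std-ominus : ∀ {x y} → y < x → std (x ∷ y ∷ []) ≡ ominus
std-ominus {x} {y} y<x rewrite <ᵇ-false {x} (<-irrefl refl) | <ᵇ-false (<-asym y<x)
  | <ᵇ-true y<x | <ᵇ-false {y} (<-irrefl refl) = refl

≪-++ : ∀ {s t u} → s ≪ t → s ≪ u → s ≪ t ++ u
≪-++ s≪t s≪u = All.zipWith (λ where (x , y) → All.++⁺ x y) (s≪t , s≪u)

≪-acyclic : ∀ {a b c} → a ≢ [] → b ≢ [] → c ≢ [] → a ≪ b → b ≪ c → c ≪ a → ⊥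
≪-acyclic a b c a≪b b≪c c≪a =
  <-irrefl refl (<-trans (≪-hd a b a≪b) (<-trans (≪-hd b c b≪c) (≪-hd c a c≪a)))

-- This is why no permutation of size 3 is simple. Of the eight ways to order the three pairs, the
-- two cyclic ones are impossible, and in the others two neighbours merge.
Apart-pair : ∀ {a b c} → a ≢ [] → b ≢ [] → c ≢ [] → Apart a b → Apart a c → Apart b c →
             Apart c (concat (a ∷ b ∷ [])) ⊎ Apart a (concat (b ∷ c ∷ []))
Apart-pair {a} {b} {c} na nb nc ab ac bc = subst₂ (λ v w → Apart c (a ++ v) ⊎ Apart a (b ++ w))
  (sym (++-identityʳ b)) (sym (++-identityʳ c)) (cases ab ac bc)
  where
  cases : Apart a b → Apart a c → Apart b c → Apart c (a ++ b) ⊎ Apart a (b ++ c)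
  cases _          (inj₁ a≪c) (inj₁ b≪c) = inj₁ (inj₂ (All.++⁺ a≪c b≪c))
  cases _          (inj₂ c≪a) (inj₂ c≪b) = inj₁ (inj₁ (≪-++ c≪a c≪b))
  cases (inj₁ a≪b) (inj₁ a≪c) (inj₂ c≪b) = inj₂ (inj₁ (≪-++ a≪b a≪c))
  cases (inj₂ b≪a) (inj₂ c≪a) (inj₁ b≪c) = inj₂ (inj₂ (All.++⁺ b≪a c≪a))
  cases (inj₁ a≪b) (inj₂ c≪a) (inj₁ b≪c) = ⊥-elim (≪-acyclic na nb nc a≪b b≪c c≪a)
  cases (inj₂ b≪a) (inj₁ a≪c) (inj₂ c≪b) = ⊥-elim (≪-acyclic nb na nc b≪a a≪c c≪b)

root-quotient : ∀ {segs} → NonEmpty segs → AllPairs Apart segs → 2 ≤ length segs →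
  ¬ Any Mergeable (factors segs) → Root (labels (quotient segs))
root-quotient {[]}         _ _ () _
root-quotient {_ ∷ []}     _ _ (s≤s ()) _
root-quotient {a ∷ b ∷ []} (na ∷ nb ∷ []) ((inj₁ a≪b ∷ []) ∷ _) _ _ =
  inj₁ (std-oplus (≪-hd na nb a≪b))
root-quotient {a ∷ b ∷ []} (na ∷ nb ∷ []) ((inj₂ b≪a ∷ []) ∷ _) _ _ =
  inj₂ (inj₁ (std-ominus (≪-hd nb na b≪a)))
root-quotient {a ∷ b ∷ c ∷ []} (na ∷ nb ∷ nc ∷ []) ((ab ∷ ac ∷ []) ∷ (bc ∷ []) ∷ _) _ ¬merge
  with Apart-pair na nb nc ab ac bc
... | inj₁ c-ab = contradiction
  (lose (∈-factors⁺ [] (a ∷ b ∷ []) [ c ]) (≤-refl , ≤-refl , c-ab ∷ [])) ¬merge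
... | inj₂ a-bc = contradiction
  (lose (∈-factors⁺ [ a ] (b ∷ c ∷ []) []) (≤-refl , ≤-refl , a-bc ∷ [])) ¬merge
root-quotient {_ ∷ _ ∷ _ ∷ _ ∷ _} ne ap _ ¬merge =
  inj₂ (inj₂ (simple-quotient ne ap (s≤s (s≤s (s≤s (s≤s z≤n)))) ¬merge))

-- Start from singletons and merge runs of segments that form an interval, until none is left.
decompose : ∀ n segs → length segs ≤ n → IsPerm (concat segs) → NonEmpty segs → AllPairs Apart segs →
            2 ≤ length segs → Decomposition (concat segs)
decompose zero [] _ _ _ _ ()
decompose (suc n) segs len perm ne ap 2≤ with Any.any? mergeable? (factors segs)
... | no ¬merge = quotient-decomposition perm ne ap 2≤ (root-quotient ne ap 2≤ ¬merge)
... | yes merge with find merge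
...   | (pre , mid , suf) , f∈ , 2≤mid , 1≤rest , apart with ∈-factors⁻ segs f∈
...     | refl = subst Decomposition concat≡
  (decompose n merged shorter (subst IsPerm (sym concat≡) perm) ne′ ap′ 2≤′)
  where
  merged : List Word
  merged = pre ++ [ concat mid ] ++ suf
  bring : merged ↭ concat mid ∷ pre ++ suf
  bring = shift (concat mid) pre suf
  concat≡ : concat merged ≡ concat (pre ++ mid ++ suf)
  concat≡ = trans (sym (concat-++ pre (concat mid ∷ suf)))
    (trans (cong (concat pre ++_) (concat-++ mid suf)) (concat-++ pre (mid ++ suf)))
  neMid : NonEmpty mid
  neMid = All.++⁻ˡ mid (All.++⁻ʳ pre ne)
  ne′ : NonEmpty merged
  ne′ = All.++⁺ (All.++⁻ˡ pre ne) (concat≢[] neMid (<⇒≤ 2≤mid) ∷ All.++⁻ʳ mid (All.++⁻ʳ pre ne))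
  ap′ : AllPairs Apart merged
  ap′ = AllPairs-resp-↭ Apart-sym (↭-sym bring)
    (All.map Apart-sym apart ∷ AllPairs-++⁻ʳ mid (AllPairs-resp-↭ Apart-sym (shifts pre mid) ap))
  2≤′ : 2 ≤ length merged
  2≤′ = subst (2 ≤_) (sym (↭-length bring)) (s≤s 1≤rest)
  shorter : length merged ≤ n
  shorter = ≤-pred (≤-trans (begin
    suc (length merged)               ≡⟨ cong suc (↭-length bring) ⟩
    2 + length (pre ++ suf)           ≤⟨ +-monoˡ-≤ _ 2≤mid ⟩
    length mid + length (pre ++ suf)  ≡⟨ length-++ mid ⟨
    length (mid ++ pre ++ suf)        ≡⟨ ↭-length (shifts pre mid) ⟨
    length (pre ++ mid ++ suf)        ∎) len)
    where open ≤-Reasoning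

decomposition : ∀ {σ} → IsPerm σ → 2 ≤ length σ → Decomposition σ
decomposition {σ} perm 2≤ = subst Decomposition concat≡
  (decompose (length (map [_] σ)) (map [_] σ) ≤-refl (subst IsPerm (sym concat≡) perm)
    (All.map⁺ (All.universal (λ _ ()) σ))
    (AllPairs.map⁺ (AllPairs.map apart (IsPerm⇒Unique perm)))
    (subst (2 ≤_) (sym (length-map [_] σ)) 2≤))
  where
  concat≡ : concat (map [_] σ) ≡ σ
  concat≡ = concat-map-[ σ ]
  apart : ∀ {x y} → x ≢ y → Apart [ x ] [ y ]
  apart {x} {y} x≢y with <-cmp x y
  ... | tri< x<y _ _ = inj₁ ((x<y ∷ []) ∷ [])
  ... | tri≈ _ x≡y _ = contradiction x≡y x≢y
  ... | tri> _ _ y<x = inj₂ ((y<x ∷ []) ∷ [])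

-- Substitution closure

≼-length : ∀ {π σ} → π ≼ σ → length π ≤ length σ
≼-length (τ , τ⊆σ , refl) = subst (_≤ _) (sym (length-std τ)) (⊆.length-mono-≤ τ⊆σ)

Av-≼ : ∀ {B σ ρ} → Av B σ → IsPerm ρ → 1 ≤ length ρ → ρ ≼ σ → Av B ρ
Av-≼ (_ , _ , avoids) perm 1≤ ρ≼σ = perm , 1≤ , λ π π∈ π≼ρ → avoids π π∈ (≼-trans π≼ρ ρ≼σ)

-- Stands in for `SubstClosure (Av B)`, with which `closure⇒` and `closure⇐` identify it once 12 and
-- 21 are in the class. Unlike membership in a level, it visibly passes to nonempty patterns.
SimplesIn : List Word → Word → Set
SimplesIn B σ = IsPerm σ × 1 ≤ length σ × (∀ ρ → Simple ρ → ρ ≼ σ → Av B ρ)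

Av⇒SimplesIn : ∀ {B σ} → Av B σ → SimplesIn B σ
Av⇒SimplesIn av@(perm , 1≤ , _) = perm , 1≤ , λ ρ simple ρ≼σ →
  Av-≼ av (proj₁ simple) (≤-trans (s≤s z≤n) (proj₁ (proj₂ simple))) ρ≼σ

SimplesIn-inflateL : ∀ {B L} → Av B (labels L) → All (SimplesIn B ∘ proj₂) L → SimplesIn B (inflateL L)
SimplesIn-inflateL {B} {L} av@(perm , 1≤ , _) ss = IsPerm-inflateL perms ,
  ≤-trans 1≤ (≼-length (labels-≼ perms perm (All.map (1≤length⇒≢[] ∘ proj₁ ∘ proj₂) ss))) ,
  simples
  where
  perms : Perms L
  perms = IsPerm⇒Unique perm , All.map proj₁ ss
  simples : ∀ ρ → Simple ρ → ρ ≼ inflateL L → Av B ρ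
  simples ρ simple ρ≼ with simple-≼-inflateL perms simple ρ≼
  ... | inj₁ ρ≼labels = proj₂ (proj₂ (Av⇒SimplesIn av)) ρ simple ρ≼labels
  ... | inj₂ ρ≼part with find ρ≼part
  ...   | a , a∈ , ρ≼a = proj₂ (proj₂ (All.lookup ss a∈)) ρ simple ρ≼a

Pointwise⇒Labelled : ∀ {R : ℕ → Word → Set} {π ps} → Pointwise R π ps →
  ∃[ L ] (labels L ≡ π × parts L ≡ ps × All (λ a → R (proj₁ a) (proj₂ a)) L)
Pointwise⇒Labelled [] = [] , refl , refl , []
Pointwise⇒Labelled (r ∷ rs) with Pointwise⇒Labelled rs
... | L , refl , refl , all = (_ , _) ∷ L , refl , refl , r ∷ all

CLevel⇒SimplesIn : ∀ {B} k {σ} → CLevel (Av B) k σ → SimplesIn B σ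
CLevel⇒SimplesIn zero    av = Av⇒SimplesIn av
CLevel⇒SimplesIn (suc k) (τ , ps , av , _ , pw , refl) with Pointwise⇒Labelled pw
... | L , refl , refl , all = SimplesIn-inflateL av (All.map (CLevel⇒SimplesIn k) all)

module Closure {B : List Word} (oplus∈ : Av B oplus) (ominus∈ : Av B ominus) where

  one∈ : Av B one
  one∈ = Av-≼ oplus∈ ↭-refl ≤-refl (one-≼ {oplus} λ ())

  -- A simple root is a pattern of `σ`, hence in the class, and the parts are patterns of `σ`, hence
  -- inherit the condition on simple patterns.
  SimplesIn-decomposition : ∀ {σ} → SimplesIn B σ → 2 ≤ length σ →
    ∃[ L ] (Root (labels L) × Av B (labels L) × All (λ a → SimplesIn B (proj₂ a) × length (proj₂ a) < length σ) L ×
            σ ≡ inflateL L)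
  SimplesIn-decomposition {σ} (perm , _ , simples) 2≤ with decomposition perm 2≤
  ... | L , root , ps , nes , refl = L , root , labels∈ root ,
        All.tabulate (λ a∈ → partIn a∈ , proj₂ (All.lookup nes a∈)) , refl
    where
    labels∈ : Root (labels L) → Av B (labels L)
    labels∈ (inj₁ eq)            = subst (Av B) (sym eq) oplus∈
    labels∈ (inj₂ (inj₁ eq))     = subst (Av B) (sym eq) ominus∈
    labels∈ (inj₂ (inj₂ simple)) = simples _ simple (labels-≼ ps (proj₁ simple) (All.map proj₁ nes))
    partIn : ∀ {a} → a ∈ L → SimplesIn B (proj₂ a)
    partIn {p , s} a∈ = All.lookup (proj₂ ps) a∈ , nonempty (proj₁ (All.lookup nes a∈)) ,
      λ ρ simple ρ≼s → simples ρ simple (≼-trans ρ≼s (part-≼ ps a∈))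
      where
      nonempty : ∀ {s : Word} → s ≢ [] → 1 ≤ length s
      nonempty {[]}    s≢[] = contradiction refl s≢[]
      nonempty {_ ∷ _} _    = s≤s z≤n

  perm-one : ∀ {σ} → IsPerm σ → length σ ≡ 1 → σ ≡ one
  perm-one {x ∷ []} perm _ = trans (sym (std-perm perm)) (std-singleton x)

  -- Parts of a decomposition may bottom out early; since `one` is the inflation of `one` by itself,
  -- it is available at whatever level is asked for.
  one-CLevel : ∀ n → CLevel (Av B) n one
  one-CLevel zero    = one∈
  one-CLevel (suc n) = one , [ one ] , one∈ , refl , one-CLevel n ∷ [] , refl

  -- Parts are strictly shorter than the word, so one level is spent per unit of length.
  SimplesIn⇒CLevel : ∀ n {σ} → length σ ≤ suc n → SimplesIn B σ → CLevel (Av B) n σ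
  SimplesIn⇒CLevel n {σ} len s with 2 ≤? length σ
  SimplesIn⇒CLevel n len (perm , 1≤ , _) | no 2≰ =
    subst (CLevel (Av B) n) (sym (perm-one perm (≤-antisym (≤-pred (≰⇒> 2≰)) 1≤))) (one-CLevel n)
  SimplesIn⇒CLevel zero    len s | yes 2≤ = contradiction 2≤ (≤⇒≯ len)
  SimplesIn⇒CLevel (suc n) len s | yes 2≤ with SimplesIn-decomposition s 2≤
  ... | L , _ , av , all , refl = labels L , parts L , av ,
        trans (length-map proj₂ L) (sym (length-map proj₁ L)) , levels all , refl
    where
    levels : ∀ {M} → All (λ a → SimplesIn B (proj₂ a) × length (proj₂ a) < length (inflateL L)) M →
             Pointwise (λ _ p → CLevel (Av B) n p) (labels M) (parts M)
    levels []               = []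
    levels ((s , s<) ∷ all) = SimplesIn⇒CLevel n (≤-pred (≤-trans s< len)) s ∷ levels all

  closure⇒ : ∀ {σ} → SubstClosure (Av B) σ → SimplesIn B σ
  closure⇒ (k , level) = CLevel⇒SimplesIn k level

  closure⇐ : ∀ {σ} → SimplesIn B σ → SubstClosure (Av B) σ
  closure⇐ {σ} s = length σ , SimplesIn⇒CLevel (length σ) (n≤1+n _) s

  closure-BStar-free : ∀ {σ} → IsBasis B → (SubstClosure (Av B) σ × Avoids (BStar B) σ) ⇔ Av B σ
  closure-BStar-free {σ} basis = mk⇔ to from
    where
    to : SubstClosure (Av B) σ × Avoids (BStar B) σ → Av B σ
    to (c , avoids) with closure⇒ c
    ... | perm , 1≤ , simples = perm , 1≤ , avoidsB
      where
      avoidsB : Avoids (_∈ B) σ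
      avoidsB b b∈ b≼σ with simple? b
      -- A simple `b` occurring in `σ` would lie in the class, and so would avoid itself.
      ... | yes simple = proj₂ (proj₂ (simples b simple b≼σ)) b b∈ (≼-refl (proj₁ simple))
      ... | no ¬simple = avoids b (b∈ , ¬simple) b≼σ
    from : Av B σ → SubstClosure (Av B) σ × Avoids (BStar B) σ
    from av = (0 , av) , λ b b∈ → proj₂ (proj₂ av) b (proj₁ b∈)

-- Normalized blocks, sublists and choices

-- Allows a factor of `std mid` to be carried back to a factor of `mid` by a mere translation.
Consec-std : ∀ {mid} → Consec mid → ∃[ a ] mid ≡ map (a +_) (std mid)
Consec-std {mid} (a , p) = a , trans (sym shifted) (cong (map (a +_)) γ≡)
  where
  γ : Word
  γ = map (_∸ a) mid
  shifted : map (a +_) γ ≡ mid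
  shifted = trans (sym (map-∘ mid)) (map-id-local (All.map (m+[n∸m]≡n ∘ proj₁) (proj₂ (↭⇒Range p))))
  perm : IsPerm γ
  perm = ↭-trans (↭.map⁺ (_∸ a) p) (↭-reflexive (trans (sym (map-∘ (upTo (length mid))))
    (trans (map-id-local (All.universal (m+n∸m≡n a) _)) (cong upTo (sym (length-map (_∸ a) mid))))))
  γ≡ : γ ≡ std mid
  γ≡ = trans (sym (std-perm perm)) (trans (sym (std-shift a γ)) (cong std shifted))

-- Used to see that the pieces of a forbidden block are themselves blocks of an element of B⋆, so
-- they are among the candidates for exclusion.
NormBlock-trans : ∀ {β γ σ} → NormBlock β γ → NormBlock γ σ → NormBlock β σ
NormBlock-trans (pre′ , m , suf′ , eq , m≢[] , (a′ , p) , refl) (pre , mid , suf , refl , _ , c , refl)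
  with Consec-std c
... | a , mid≡ = pre ++ map (a +_) pre′ , map (a +_) m , map (a +_) suf′ ++ suf , split ,
      m≢[] ∘ map≡[] m , (a + a′ , consec) , sym (std-shift a m)
  where
  open ≡-Reasoning
  split : pre ++ mid ++ suf ≡ (pre ++ map (a +_) pre′) ++ map (a +_) m ++ map (a +_) suf′ ++ suf
  split = begin
    pre ++ mid ++ suf                                   ≡⟨ cong (λ w → pre ++ w ++ suf) (trans mid≡ (cong (map (a +_)) eq)) ⟩
    pre ++ map (a +_) (pre′ ++ m ++ suf′) ++ suf        ≡⟨ cong (λ w → pre ++ w ++ suf) (trans (map-++ (a +_) pre′ _) (cong (P ++_) (map-++ (a +_) m suf′))) ⟩
    pre ++ (P ++ M ++ Q) ++ suf                         ≡⟨ cong (pre ++_) (trans (++-assoc P (M ++ Q) suf) (cong (P ++_) (++-assoc M Q suf))) ⟩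
    pre ++ P ++ M ++ Q ++ suf                           ≡⟨ ++-assoc pre P _ ⟨
    (pre ++ P) ++ M ++ Q ++ suf                         ∎
    where
    P M Q : Word
    P = map (a +_) pre′
    M = map (a +_) m
    Q = map (a +_) suf′
  consec : map (a +_) m ↭ map (a + a′ +_) (upTo (length (map (a +_) m)))
  consec = ↭-trans (↭.map⁺ (a +_) p) (↭-reflexive (trans (sym (map-∘ (upTo (length m))))
    (trans (map-cong (λ x → sym (+-assoc a a′ x)) (upTo (length m)))
           (cong (λ n → map (a + a′ +_) (upTo n)) (sym (length-map (a +_) m))))))

NormBlock-refl : ∀ {σ} → IsPerm σ → σ ≢ [] → NormBlock σ σ
NormBlock-refl {σ} perm σ≢[] = [] , σ , [] , sym (++-identityʳ σ) , σ≢[] ,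
  (0 , ↭-trans perm (↭-reflexive (sym (map-id _)))) , sym (std-perm perm)

NormBlock-≢[] : ∀ {β σ} → NormBlock β σ → β ≢ []
NormBlock-≢[] (_ , mid , _ , _ , mid≢[] , _ , refl) = mid≢[] ∘ map≡[] mid

interval? : (f : Word × Word × Word) → Dec (proj₁ (proj₂ f) ≢ [] × Consec (proj₁ (proj₂ f)))
interval? (_ , mid , _) = ¬? (null? mid) ×-dec consec? mid

normBlocks : Word → List Word
normBlocks σ = map (std ∘ proj₁ ∘ proj₂) (filter interval? (factors σ))

∈-normBlocks⁺ : ∀ {β σ} → NormBlock β σ → β ∈ normBlocks σ
∈-normBlocks⁺ (pre , mid , suf , refl , mid≢[] , c , refl) =
  ∈-map⁺ (std ∘ proj₁ ∘ proj₂) (∈-filter⁺ interval? (∈-factors⁺ pre mid suf) (mid≢[] , c))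

∈-normBlocks⁻ : ∀ {β σ} → β ∈ normBlocks σ → NormBlock β σ
∈-normBlocks⁻ {σ = σ} β∈ with ∈-map⁻ (std ∘ proj₁ ∘ proj₂) β∈
... | (pre , mid , suf) , f∈ , refl with ∈-filter⁻ interval? {xs = factors σ} f∈
...   | f∈′ , mid≢[] , c = pre , mid , suf , ∈-factors⁻ σ f∈′ , mid≢[] , c , refl

sublists : ∀ {A : Set} → List A → List (List A)
sublists []       = [ [] ]
sublists (x ∷ xs) = sublists xs ++ map (x ∷_) (sublists xs)

∈-sublists⁺ : ∀ {A : Set} {xs ys : List A} → xs ⊆ ys → xs ∈ sublists ys
∈-sublists⁺ []                          = here refl
∈-sublists⁺ (_ ∷ʳ s)                    = ∈-++⁺ˡ (∈-sublists⁺ s)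
∈-sublists⁺ {ys = y ∷ ys} (refl ∷ s) = ∈-++⁺ʳ (sublists ys) (∈-map⁺ (y ∷_) (∈-sublists⁺ s))

∈-sublists⁻ : ∀ {A : Set} {xs : List A} ys → xs ∈ sublists ys → xs ⊆ ys
∈-sublists⁻ []       (here refl) = []
∈-sublists⁻ (y ∷ ys) xs∈ with ∈-++⁻ (sublists ys) xs∈
... | inj₁ xs∈′ = y ∷ʳ ∈-sublists⁻ ys xs∈′
... | inj₂ xs∈′ with ∈-map⁻ (y ∷_) xs∈′
...   | _ , zs∈ , refl = refl ∷ ∈-sublists⁻ ys zs∈

-- The Cartesian product of a list of lists.
choices : ∀ {A : Set} → List (List A) → List (List A)
choices []         = [ [] ]
choices (xs ∷ xss) = concatMap (λ x → map (x ∷_) (choices xss)) xs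

∈-choices⁺ : ∀ {A : Set} {ys : List A} {xss} → Pointwise _∈_ ys xss → ys ∈ choices xss
∈-choices⁺ []                     = here refl
∈-choices⁺ {ys = y ∷ ys} (y∈ ∷ p) = ∈-concatMap⁺ _ (lose y∈ (∈-map⁺ (y ∷_) (∈-choices⁺ p)))

∈-choices⁻ : ∀ {A : Set} {ys : List A} xss → ys ∈ choices xss → Pointwise _∈_ ys xss
∈-choices⁻ []         (here refl) = []
∈-choices⁻ (xs ∷ xss) ys∈ with find (∈-concatMap⁻ (λ x → map (x ∷_) (choices xss)) {xs = xs} ys∈)
... | x , x∈ , q with ∈-map⁻ (x ∷_) q
...   | _ , zs∈ , refl = x∈ ∷ ∈-choices⁻ xss zs∈

_≟ʷ_ : (u v : Word) → Dec (u ≡ v)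
_≟ʷ_ = ≡-dec _≟_

_∈ʷ?_ : (u : Word) (us : List Word) → Dec (u ∈ us)
u ∈ʷ? us = Any.any? (u ≟ʷ_) us

_≼?_ : ∀ π σ → Dec (π ≼ σ)
π ≼? σ = map′ to from (Any.any? (λ τ → std τ ≟ʷ π) (sublists σ))
  where
  to : Any (λ τ → std τ ≡ π) (sublists σ) → π ≼ σ
  to p with find p
  ... | τ , τ∈ , eq = τ , ∈-sublists⁻ σ τ∈ , eq
  from : π ≼ σ → Any (λ τ → std τ ≡ π) (sublists σ)
  from (τ , τ⊆ , eq) = lose (∈-sublists⁺ τ⊆) eq

-- The system

bstar : List Word → List Word
bstar = filter (¬? ∘ simple?)

-- The block of size 1 is left out: avoiding it would leave no permutation at all.
blocks : List Word → List Word
blocks B = filter (λ β → ¬? (β ≟ʷ one)) (concatMap normBlocks (bstar B))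

∈-bstar : ∀ B γ → (γ ∈ bstar B) ⇔ BStar B γ
∈-bstar B γ = mk⇔ (∈-filter⁻ (¬? ∘ simple?) {xs = B}) (λ where (γ∈ , ¬s) → ∈-filter⁺ (¬? ∘ simple?) γ∈ ¬s)

∈-blocks : ∀ B β → (β ∈ blocks B) ⇔ (β ≢ one × ∃[ b ] (BStar B b × NormBlock β b))
∈-blocks B β = mk⇔ fwd bwd
  where
  open Equivalence
  ≢one? : Decidable (_≢ one)
  ≢one? β = ¬? (β ≟ʷ one)
  fwd : β ∈ blocks B → β ≢ one × ∃[ b ] (BStar B b × NormBlock β b)
  fwd β∈ with ∈-filter⁻ ≢one? {xs = concatMap normBlocks (bstar B)} β∈
  ... | β∈′ , β≢one with find (∈-concatMap⁻ normBlocks {xs = bstar B} β∈′)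
  ...   | b , b∈ , β∈b = β≢one , b , to (∈-bstar B b) b∈ , ∈-normBlocks⁻ β∈b
  bwd : β ≢ one × ∃[ b ] (BStar B b × NormBlock β b) → β ∈ blocks B
  bwd (β≢one , b , b∈ , block) = ∈-filter⁺ ≢one?
    (∈-concatMap⁺ normBlocks (lose (from (∈-bstar B b) b∈) (∈-normBlocks⁺ block))) β≢one

module Terms (Bs Bl : List Word) where

  -- A repeated entry of `Bl` merely gives several unknowns denoting the same set.
  variables : List (List Word)
  variables = sublists Bl

  Var : Set
  Var = Fin (length variables)

  excluded : Var → List Word
  excluded = lookup variables

  ∈-excluded⁻ : ∀ i {β} → β ∈ excluded i → β ∈ Bl
  ∈-excluded⁻ i = ⊆.lookup (∈-sublists⁻ Bl (∈-lookup {xs = variables} i))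

  -- The empty word stands for a part of the inflation that an occurrence does not meet.
  allowed : Var → List Word
  allowed i = [] ∷ one ∷ filter (λ β → ¬? (β ∈ʷ? excluded i)) Bl

  -- The test runs through every shape that an occurrence could still take under the constraints
  -- `as`. It involves finite lists only and never asks for membership in the closure.
  Admissible : Var → Word → List Var → Set
  Admissible i π as = All (λ γs → inflate π γs ∉ Bs ++ excluded i) (choices (map allowed as))

  admissible? : ∀ i π → Decidable (Admissible i π)
  admissible? i π as = All.all? (λ γs → ¬? (inflate π γs ∈ʷ? (Bs ++ excluded i))) (choices (map allowed as))

  tuples : Word → List (List Var)
  tuples π = choices (map (λ _ → allFin _) π)

  ∈-tuples⁺ : ∀ π {as} → length as ≡ length π → as ∈ tuples π
  ∈-tuples⁺ π eq = ∈-choices⁺ (pointwise π _ eq)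
    where
    pointwise : ∀ (π : Word) as → length as ≡ length π → Pointwise _∈_ as (map (λ _ → allFin _) π)
    pointwise []      []       _  = []
    pointwise (_ ∷ π) (a ∷ as) eq = ∈-allFin a ∷ pointwise π as (suc-injective eq)

  ∈-tuples⁻ : ∀ π {as} → as ∈ tuples π → length as ≡ length π
  ∈-tuples⁻ π as∈ = lengths π (∈-choices⁻ _ as∈)
    where
    lengths : ∀ (π : Word) {as} → Pointwise _∈_ as (map (λ _ → allFin _) π) → length as ≡ length π
    lengths []      []       = refl
    lengths (_ ∷ π) (_ ∷ pw) = cong suc (lengths π pw)

  termsAt : Var → Word → List (Term (length variables))
  termsAt i π = map (term π) (filter (admissible? i π) (tuples π))

  terms : List Word → Var → List (Term (length variables))
  terms roots i = concatMap (termsAt i) roots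

  ∈-terms⁺ : ∀ {roots i π as} → π ∈ roots → as ∈ tuples π → Admissible i π as → term π as ∈ terms roots i
  ∈-terms⁺ {i = i} {π} π∈ as∈ adm = ∈-concatMap⁺ (termsAt i)
    (lose π∈ (∈-map⁺ (term π) (∈-filter⁺ (admissible? i π) as∈ adm)))

  ∈-terms⁻ : ∀ {roots i t} → t ∈ terms roots i →
             root t ∈ roots × args t ∈ tuples (root t) × Admissible i (root t) (args t)
  ∈-terms⁻ {roots} {i} t∈ with find (∈-concatMap⁻ (termsAt i) {xs = roots} t∈)
  ... | π , π∈ , q with ∈-map⁻ (term π) q
  ...   | as , as∈ , refl with ∈-filter⁻ (admissible? i π) {xs = tuples π} as∈
  ...     | as∈′ , adm = π∈ , as∈′ , adm

  systemFor : List Word → System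
  systemFor roots = system (length variables) (λ i → plain , excluded i)
    (map (λ i → i , terms roots i) (allFin _))

-- Correctness of the computed system

module Correctness (B S : List Word) (basis : IsBasis B) (oplus∈ : Av B oplus) (ominus∈ : Av B ominus)
                   (S-spec : ∀ σ → (σ ∈ S) ⇔ (Simple σ × Av B σ))
                   (Bs Bl : List Word) (Bs-spec : ∀ γ → (γ ∈ Bs) ⇔ BStar B γ)
                   (Bl-spec : ∀ β → (β ∈ Bl) ⇔ (β ≢ one × ∃[ b ] (BStar B b × NormBlock β b))) where

  open Closure oplus∈ ominus∈
  open Equivalence
  open Terms Bs Bl

  roots : List Word
  roots = oplus ∷ ominus ∷ S

  Sy : System
  Sy = systemFor roots

  roots∈ : ∀ {π} → π ∈ roots → Root π × Av B π
  roots∈ (here refl)         = inj₁ refl , oplus∈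
  roots∈ (there (here refl)) = inj₂ (inj₁ refl) , ominus∈
  roots∈ (there (there π∈))  = map₁ (inj₂ ∘ inj₂) (to (S-spec _) π∈)

  ∈roots : ∀ {π} → Root π → Av B π → π ∈ roots
  ∈roots (inj₁ refl)          av = here refl
  ∈roots (inj₂ (inj₁ refl))   av = there (here refl)
  ∈roots (inj₂ (inj₂ simple)) av = there (there (from (S-spec _) (simple , av)))

  varOf-∈ : ∀ σ → filter (λ β → ¬? (β ≼? σ)) Bl ∈ variables
  varOf-∈ σ = ∈-sublists⁺ (⊆.filter-⊆ (λ β → ¬? (β ≼? σ)) Bl)

  varOf : Word → Var
  varOf σ = Any.index (varOf-∈ σ)

  excluded-varOf : ∀ σ → excluded (varOf σ) ≡ filter (λ β → ¬? (β ≼? σ)) Bl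
  excluded-varOf σ = sym (Any.lookup-index (varOf-∈ σ))

  forbidden : Var → PSet
  forbidden i π = BStar B π ⊎ π ∈ excluded i

  forbidden⁺ : ∀ i {γ} → γ ∈ Bs ++ excluded i → forbidden i γ
  forbidden⁺ i γ∈ with ∈-++⁻ (Bs) γ∈
  ... | inj₁ γ∈′ = inj₁ (to (Bs-spec _) γ∈′)
  ... | inj₂ γ∈′ = inj₂ γ∈′

  forbidden⁻ : ∀ i {γ} → forbidden i γ → γ ∈ Bs ++ excluded i
  forbidden⁻ i (inj₁ γ∈) = ∈-++⁺ˡ (from (Bs-spec _) γ∈)
  forbidden⁻ i (inj₂ γ∈) = ∈-++⁺ʳ (Bs) γ∈

  -- An element of B⋆ is a block of itself, so both kinds of forbidden pattern can be treated as
  -- blocks.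
  forbidden-block : ∀ i {γ} → forbidden i γ → ∃[ b ] (BStar B b × NormBlock γ b)
  forbidden-block i (inj₁ γ∈@(γ∈B , _)) with All.lookup basis γ∈B
  ... | perm , 1≤ , _ = _ , γ∈ , NormBlock-refl perm (1≤length⇒≢[] 1≤)
  forbidden-block i (inj₂ γ∈) = proj₂ (to (Bl-spec _) (∈-excluded⁻ i γ∈))

  -- Needed for the 1 on each right-hand side: it belongs to the unknown only if 1 is not forbidden.
  forbidden-≢one : ∀ i {γ} → forbidden i γ → γ ≢ one
  forbidden-≢one i (inj₁ (γ∈B , _)) refl = proj₂ (proj₂ one∈) one γ∈B (≼-refl ↭-refl)
  forbidden-≢one i (inj₂ γ∈)        = proj₁ (to (Bl-spec _) (∈-excluded⁻ i γ∈))

  one∈⟦⟧ : ∀ i → ⟦_⟧ B Sy i one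
  one∈⟦⟧ i = (0 , one∈) , λ γ γ∈ γ≼ →
    [ NormBlock-≢[] (proj₂ (proj₂ (forbidden-block i γ∈))) , forbidden-≢one i γ∈ ]′ (≼-one γ≼)

  SimplesIn-varOf : ∀ {s} → SimplesIn B s → Avoids (BStar B) s → ⟦_⟧ B Sy (varOf s) s
  SimplesIn-varOf {s} ss avoids = closure⇐ ss , λ where
    γ (inj₁ γ∈) → avoids γ γ∈
    γ (inj₂ γ∈) → proj₂ (∈-filter⁻ (λ β → ¬? (β ≼? s)) {xs = Bl} (subst (γ ∈_) (excluded-varOf s) γ∈))

  -- `varOf s` excludes as many blocks as `s` permits, so a block left over is not avoided by `s`.
  -- Decidability of `≼` turns this into containment.
  allowed-varOf : ∀ {s γ} → s ≢ [] → γ ∈ allowed (varOf s) → γ ≼ s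
  allowed-varOf {s} s≢[] (here refl)         = []-≼ s
  allowed-varOf     s≢[] (there (here refl)) = one-≼ s≢[]
  allowed-varOf {s} {γ} s≢[] (there (there γ∈))
    with ∈-filter⁻ (λ β → ¬? (β ∈ʷ? excluded (varOf s))) {xs = Bl} γ∈
  ... | γ∈′ , γ∉ = decidable-stable (γ ≼? s) λ γ⋠s →
    γ∉ (subst (γ ∈_) (sym (excluded-varOf s)) (∈-filter⁺ (λ β → ¬? (β ≼? s)) γ∈′ γ⋠s))

  allowed-≼L : ∀ {L γs} → All (λ a → proj₂ a ≢ []) L →
    Pointwise _∈_ γs (map (allowed) (map (varOf ∘ proj₂) L)) →
    ∃[ K ] (K ≼L L × labels K ≡ labels L × parts K ≡ γs)
  allowed-≼L {[]}    []         []         = [] , [] , refl , refl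
  allowed-≼L {a ∷ L} (ne ∷ nes) (γ∈ ∷ γs∈) with allowed-≼L nes γs∈
  ... | K , K≼L , eq₁ , refl = (proj₁ a , _) ∷ K , (refl , allowed-varOf ne γ∈) ∷ K≼L , cong (_ ∷_) eq₁ , refl

  ⟦⟧⊆RHS : ∀ i {σ} → ⟦_⟧ B Sy i σ → RHS B Sy (terms roots i) σ
  ⟦⟧⊆RHS i {σ} (c , avoids) with 2 ≤? length σ | closure⇒ c
  ... | no 2≰  | perm , 1≤ , _ = inj₁ (perm-one perm (≤-antisym (≤-pred (≰⇒> 2≰)) 1≤))
  ... | yes 2≤ | ss with SimplesIn-decomposition ss 2≤
  ...   | L , root , av , all , refl = inj₂ (lose
          (∈-terms⁺ {roots} {i} (∈roots root av) (∈-tuples⁺ (labels L) (trans (length-map (varOf ∘ proj₂) L) (sym (length-map proj₁ L)))) admissible)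
          (parts L , members (All.tabulate member) , refl))
    where
    perms : Perms L
    perms = IsPerm⇒Unique (proj₁ av) , All.map (proj₁ ∘ proj₁) all

    -- Allowed choices are patterns of the parts, so their inflation is a pattern of the given word,
    -- which avoids everything forbidden.
    admissible : Admissible i (labels L) (map (varOf ∘ proj₂) L)
    admissible = All.tabulate λ {γs} γs∈ γ∈ → excludes γs γs∈ (forbidden⁺ i γ∈)
      where
      excludes : ∀ γs → γs ∈ choices (map (allowed) (map (varOf ∘ proj₂) L)) →
                 forbidden i (inflate (labels L) γs) → ⊥
      excludes γs γs∈ γ∈ with allowed-≼L (All.map (1≤length⇒≢[] ∘ proj₁ ∘ proj₂ ∘ proj₁) all) (∈-choices⁻ _ γs∈)
      ... | K , K≼L , eq , refl = avoids _ γ∈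
        (subst (λ π → inflate π (parts K) ≼ inflateL L) eq (inflateL-mono perms K≼L))

    member : ∀ {a} → a ∈ L → ⟦_⟧ B Sy (varOf (proj₂ a)) (proj₂ a)
    member a∈ = SimplesIn-varOf (proj₁ (All.lookup all a∈)) λ γ γ∈ γ≼ →
      avoids γ (inj₁ γ∈) (≼-trans γ≼ (part-≼ perms a∈))

    members : ∀ {M} → All (λ a → ⟦_⟧ B Sy (varOf (proj₂ a)) (proj₂ a)) M →
              Pointwise (λ j p → ⟦_⟧ B Sy j p) (map (varOf ∘ proj₂) M) (parts M)
    members []       = []
    members (m ∷ ms) = m ∷ members ms

  labelArgs : ∀ {R : Var → Word → Set} π {as ps} → length as ≡ length π → Pointwise R as ps →
    ∃[ L ] (labels L ≡ π × parts L ≡ ps × Pointwise (λ j a → R j (proj₂ a)) as L)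
  labelArgs []      _  []       = [] , refl , refl , []
  labelArgs (p ∷ π) eq (r ∷ rs) with labelArgs π (suc-injective eq) rs
  ... | L , refl , refl , pw = (p , _) ∷ L , refl , refl , r ∷ pw

  -- A block that occurs in `s` cannot be among those excluded for `j`, since `s` avoids these.
  part-allowed : ∀ j {s γ b} → ⟦_⟧ B Sy j s → γ ≼ s → BStar B b → γ ≡ [] ⊎ NormBlock γ b →
                 γ ∈ allowed j
  part-allowed j _ _ _ (inj₁ refl) = here refl
  part-allowed j {γ = γ} (_ , avoids) γ≼s b∈ (inj₂ block) with γ ≟ʷ one
  ... | yes refl = there (here refl)
  ... | no γ≢one = there (there (∈-filter⁺ (λ β → ¬? (β ∈ʷ? excluded j))
          (from (Bl-spec _) (γ≢one , _ , b∈ , block)) (λ γ∈ → avoids γ (inj₂ γ∈) γ≼s)))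

  parts-allowed : ∀ {as K L b} → Pointwise (λ j a → ⟦_⟧ B Sy j (proj₂ a)) as L → K ≼L L → BStar B b →
    All (λ a → proj₂ a ≡ [] ⊎ NormBlock (proj₂ a) b) K →
    Pointwise _∈_ (parts K) (map (allowed) as)
  parts-allowed []                 []               b∈ []             = []
  parts-allowed {j ∷ _} (m ∷ ms) ((_ , γ≼) ∷ K≼L) b∈ (block ∷ blocks) =
    part-allowed j m γ≼ b∈ block ∷ parts-allowed ms K≼L b∈ blocks

  TermSet⊆⟦⟧ : ∀ i {t σ} → t ∈ terms roots i → TermSet B Sy t σ → ⟦_⟧ B Sy i σ
  TermSet⊆⟦⟧ i {t} t∈ (ps , pw , refl) with ∈-terms⁻ {roots} {i} t∈
  ... | π∈ , as∈ , adm with labelArgs (root t) (∈-tuples⁻ (root t) as∈) pw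
  ...   | L , refl , refl , ms = closure⇐ (SimplesIn-inflateL av simples) , avoids
    where
    av : Av B (labels L)
    av = proj₂ (roots∈ π∈)

    simplesIn : ∀ {as M} → Pointwise (λ j a → ⟦_⟧ B Sy j (proj₂ a)) as M → All (SimplesIn B ∘ proj₂) M
    simplesIn []             = []
    simplesIn ((c , _) ∷ ms) = closure⇒ c ∷ simplesIn ms

    simples : All (SimplesIn B ∘ proj₂) L
    simples = simplesIn ms

    avoids : Avoids (forbidden i) (inflateL L)
    avoids γ γ∈ γ≼ with ≼-inflateL⁻ (IsPerm⇒Unique (proj₁ av) , All.map proj₁ simples) γ≼
                      | forbidden-block i γ∈
    ... | K , psK , K≼L , refl | b , b∈ , block =
      -- The pieces of the occurrence are one of the tested choices, and their inflation is `γ`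
      -- itself, which admissibility declares not forbidden.
      All.lookup adm (∈-choices⁺ (parts-allowed ms K≼L b∈ (All.tabulate blockOf)))
        (subst (λ π → inflate π (parts K) ∈ Bs ++ excluded i) (labels-≼L K≼L) (forbidden⁻ i γ∈))
      where
      blockOf : ∀ {a} → a ∈ K → proj₂ a ≡ [] ⊎ NormBlock (proj₂ a) b
      blockOf {a} a∈ with null? (proj₂ a)
      ... | yes eq = inj₁ eq
      ... | no ne  = inj₂ (NormBlock-trans (part-NormBlock psK a∈ ne) block)
      labels-≼L : ∀ {K L} → K ≼L L → labels K ≡ labels L
      labels-≼L []               = refl
      labels-≼L ((refl , _) ∷ K≼L) = cong (_ ∷_) (labels-≼L K≼L)

  equation : ∀ i σ → ⟦_⟧ B Sy i σ ⇔ RHS B Sy (terms roots i) σ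
  equation i σ = mk⇔ (⟦⟧⊆RHS i) λ where
    (inj₁ refl) → one∈⟦⟧ i
    (inj₂ any)  → case find any of λ where (t , t∈ , σ∈) → TermSet⊆⟦⟧ i t∈ σ∈

  wellFormed : ∀ i → All (WellFormedTerm B Sy) (terms roots i)
  wellFormed i = All.tabulate λ {t} t∈ → case ∈-terms⁻ {roots} {i} t∈ of λ where
    (π∈ , as∈ , _) → proj₁ (roots∈ π∈) , ∈-tuples⁻ (root t) as∈

  -- The unknown with no block excluded, which denotes the class itself.
  initial : Var
  initial = Any.index (∈-sublists⁺ (⊆.[]⊆-universal Bl))

  excluded-initial : excluded initial ≡ []
  excluded-initial = sym (Any.lookup-index (∈-sublists⁺ (⊆.[]⊆-universal Bl)))

  initial-Av : ∀ σ → ⟦_⟧ B Sy initial σ ⇔ Av B σ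
  initial-Av σ = mk⇔
    (λ where (c , avoids) → to (closure-BStar-free basis) (c , λ γ γ∈ → avoids γ (inj₁ γ∈)))
    (λ av → case from (closure-BStar-free basis) av of λ where
      (c , avoids) → c , λ where
        γ (inj₁ γ∈) → avoids γ γ∈
        γ (inj₂ γ∈) → case subst (γ ∈_) excluded-initial γ∈ of λ ())

  valid : ValidSystem B Sy
  valid = (λ i → All.tabulate λ β∈ → proj₂ (to (Bl-spec _) (∈-excluded⁻ i β∈)))
    , All.map⁺ (All.universal (λ i → wellFormed i , equation i) (allFin _))
    , lose (∈-map⁺ (λ i → i , terms roots i) (∈-allFin initial)) initial-Av
    , All.map⁺ (All.universal (λ i → All.universal (λ t → All.universal isLhs (args t)) (terms roots i)) (allFin _))
    where
    isLhs : ∀ j → IsLhs B Sy j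
    isLhs j = lose (∈-map⁺ (λ i → i , terms roots i) (∈-allFin j)) refl

theorem5p1 : Σ (List Word → List Word → System) λ algo →
    ∀ (B S : List Word) →
    IsBasis B →
    Av B (0 ∷ 1 ∷ []) →
    Av B (1 ∷ 0 ∷ []) →
    (∀ σ → (σ ∈ S) ⇔ (Simple σ × Av B σ)) →
    ValidSystem B (algo B S)
theorem5p1 = (λ B S → Terms.systemFor (bstar B) (blocks B) (oplus ∷ ominus ∷ S)) ,
  λ B S basis oplus∈ ominus∈ S-spec → Correctness.valid B S basis oplus∈ ominus∈ S-spec
    (bstar B) (blocks B) (∈-bstar B) (∈-blocks B)
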